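{- Let $2\le k\le\log n$. Assume the set intersection hypothesis (every data structure solving the set intersection problem on $N$ sets requires $\tilde\Omega(N^2)$ space). Then any $(k,k+2)$-distinguisher oracle for graphs with $n$ vertices and maximum degree $\Theta(n^{1/k})$ must use $\tilde\Omega(n^2)$ space.
   Context: Graphs are undirected and unweighted; $d(u,v)$ is the length of a shortest path between $u$ and $v$ ($\infty$ if there is none); $k$ is an integer. For positive integers $a$ and $b$, an $(a,b)$-distinguisher oracle for a graph $G=(V,E)$ is a data structure (word-RAM model, space counted in words) that, given $u,v\in V$, establishes in constant time whether $d(u,v)\le a$ or $d(u,v)\ge b$; if $a<d(u,v)<b$ the data structure may return an arbitrary answer. Set intersection problem: let $X=\log^{c_0} N$ for a large enough constant $c_0$. Construct a data structure that preprocesses sets $S_1,\dots,S_N\subseteq[X]=\{1,\dots,X\}$ and answers queries of the form "does $S_i$ intersect $S_j$?" in constant time. Set intersection hypothesis: a data structure that solves the set intersection problem requires $\tilde\Omega(N^2)$ space. $\tilde\Omega(\cdot)$ suppresses poly-logarithmic factors. The lower bound is for the worst case over graphs in the stated family. -}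

module Defs where

open import Data.Bool.Base using (Bool; true; false; not; if_then_else_; _∧_; _∨_; _xor_)
open import Data.Fin.Base using (Fin; toℕ; fromℕ<; finToFun; funToFin)
open import Data.Fin.Properties as Fin using (2↔Bool)
open import Data.Fin.Subset using (Subset; _∈_; _∉_; _∩_; Nonempty; ∣_∣)
open import Data.List.Base using (List; head; drop; map; allFin)
open import Data.List.Extrema.Nat using (max)
open import Data.Maybe.Base using (Maybe; just; nothing)
open import Data.Nat.Base
open import Data.Nat.DivMod using (_mod_)
open import Data.Nat.Logarithm using (⌊log₂_⌋)
open import Data.Nat.Properties using (m^n≢0; _≟_; _<?_)
open import Data.Product.Base using (Σ; ∃; _×_; proj₁)
open import Data.Vec.Base using (Vec; lookup)
open import Function.Bundles using (_⇔_; module Inverse)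
open import Relation.Binary.Definitions using (DecidableEquality)
open import Relation.Binary.PropositionalEquality.Core using (_≡_)
open import Relation.Nullary.Decidable.Core using (does; yes; no)

------------------------------------------------------------------------
-- Asymptotics

Eventually : (ℕ → Set) → Set
Eventually P = ∃ λ n₀ → ∀ n → n₀ ≤ n → P n

-- f ∈Ω̃ g  says that f(n) ≥ g(n) / (C · logᵉ n) for all large n, where the
-- constants C and e are arbitrary.
_∈Ω̃_ : (f g : ℕ → ℕ) → Set
f ∈Ω̃ g = ∃ λ C → ∃ λ e → Eventually λ n → g n ≤ C * ⌊log₂ n ⌋ ^ e * f n

------------------------------------------------------------------------
-- The word RAM

Word : ℕ → Set
Word w = Fin (2 ^ w)

wrap : ∀ w → ℕ → Word w
wrap w m = _mod_ m (2 ^ w) {{m^n≢0 2 w}}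

bitwise : ∀ w → (Bool → Bool → Bool) → Word w → Word w → Word w
bitwise w f x y = funToFin {w} {2} λ i →
  Inverse.from 2↔Bool (f (bit x i) (bit y i))
  where
  bit : Word w → Fin w → Bool
  bit z i = Inverse.to 2↔Bool (finToFun {2} {w} z i)

data Op : Set where
  add sub mul div mod and or xor shl shr : Op

-- Arithmetic is modulo 2ʷ. Dividing by zero gives 0, and so does reducing
-- modulo zero.
⟦_⟧ : Op → ∀ w → Word w → Word w → Word w
⟦ add ⟧ w x y = wrap w (toℕ x + toℕ y)
⟦ sub ⟧ w x y = wrap w (toℕ x + (2 ^ w ∸ toℕ y))
⟦ mul ⟧ w x y = wrap w (toℕ x * toℕ y)
⟦ div ⟧ w x y with toℕ y
... | zero  = wrap w 0
... | suc d = wrap w (toℕ x / suc d)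
⟦ mod ⟧ w x y with toℕ y
... | zero  = wrap w 0
... | suc d = wrap w (toℕ x % suc d)
⟦ and ⟧ w x y = bitwise w _∧_ x y
⟦ or ⟧  w x y = bitwise w _∨_ x y
⟦ xor ⟧ w x y = bitwise w _xor_ x y
⟦ shl ⟧ w x y = wrap w (toℕ x * 2 ^ toℕ y)
⟦ shr ⟧ w x y = wrap w (_/_ (toℕ x) (2 ^ toℕ y) {{m^n≢0 2 (toℕ y)}})

Register Label : Set
Register = ℕ
Label    = ℕ

data Instruction : Set where
  const    : (target : Register) → ℕ → Instruction
  op       : Op → (target source₁ source₂ : Register) → Instruction
  load     : (target address : Register) → Instruction
  store    : (source address : Register) → Instruction
  jump     : Label → Instruction
  jumpLess : (left right : Register) → Label → Instruction
  halt     : (answer : Register) → Instruction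

-- Labels are absolute positions in this list.
Program : Set
Program = List Instruction

record State (w : ℕ) : Set where
  constructor state
  field
    pc        : Label
    registers : Register → Word w
    memory    : Word w → Word w

update : ∀ {A B : Set} → DecidableEquality A → (A → B) → A → B → A → B
update _≟′_ f a b x = if does (x ≟′ a) then b else f x

module _ (w : ℕ) where

  -- The Boolean answer is "yes" exactly when the register is nonzero.
  isNonzero : Word w → Bool
  isNonzero x = not (does (toℕ x ≟ 0))

  -- Run for at most the given number of steps; the result is  nothing  if the
  -- program has not halted by then, or has left its code.
  run : Program → ℕ → State w → Maybe Bool
  exec : Program → ℕ → State w → Maybe Instruction → Maybe Bool

  run P zero    s = nothing
  run P (suc t) s = exec P t s (head (drop (State.pc s) P))

  exec P t s nothing = nothing
  exec P t (state pc R M) (just (const r m)) =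
    run P t (state (suc pc) (update _≟_ R r (wrap w m)) M)
  exec P t (state pc R M) (just (op o r a b)) =
    run P t (state (suc pc) (update _≟_ R r (⟦ o ⟧ w (R a) (R b))) M)
  exec P t (state pc R M) (just (load r a)) =
    run P t (state (suc pc) (update _≟_ R r (M (R a))) M)
  exec P t (state pc R M) (just (store r a)) =
    run P t (state (suc pc) R (update Fin._≟_ M (R a) (R r)))
  exec P t (state pc R M) (just (jump l)) =
    run P t (state l R M)
  exec P t (state pc R M) (just (jumpLess a b l)) =
    run P t (state (if toℕ (R a) <ᵇ toℕ (R b) then l else suc pc) R M)
  exec P t (state pc R M) (just (halt r)) = just (isNonzero (R r))

  -- The stored words occupy the addresses 0, 1, …, s - 1; all other cells
  -- start out as zero and serve as scratch space for the query.
  image : ∀ {s} → Vec (Word w) s → Word w → Word w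
  image {s} v a with toℕ a <? s
  ... | yes a<s = lookup v (fromℕ< a<s)
  ... | no  _   = wrap w 0

  inputs : (x y : ℕ) → Register → Word w
  inputs x y 0             = wrap w x
  inputs x y 1             = wrap w y
  inputs x y (suc (suc _)) = wrap w 0

  initial : ∀ {s} → Vec (Word w) s → (x y : ℕ) → State w
  initial v x y = state 0 (inputs x y) (image v)

------------------------------------------------------------------------
-- Static data structures with constant query time

-- Queries to an instance of size n are pairs of elements of Fin n.
record Problem : Set₁ where
  field
    Instance   : ℕ → Set
    Acceptable : ∀ {n} → Instance n → (x y : Fin n) → (answer : Bool) → Set

-- One program and one time bound serve all sizes n (preprocessing may store
-- n itself, or anything derived from it, in memory). The word size is
-- Θ(log n).  space n  is the worst-case number of words over the instances
-- of size n: shorter images can be padded with zeros.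
record DataStructure (𝒫 : Problem) : Set where
  open Problem 𝒫
  field
    wordSize       : ℕ → ℕ
    wordSizeFactor : ℕ
    wordSize-lower : ∀ n → n ≤ 2 ^ wordSize n
    wordSize-upper : ∀ n → wordSize n ≤ wordSizeFactor * suc ⌊log₂ n ⌋
    space          : ℕ → ℕ
    preprocess     : ∀ {n} → Instance n → Vec (Word (wordSize n)) (space n)
    program        : Program
    time           : ℕ
    correct        : ∀ {n} (I : Instance n) (x y : Fin n) → ∃ λ answer →
                     run (wordSize n) program time
                       (initial (wordSize n) (preprocess I) (toℕ x) (toℕ y))
                       ≡ just answer
                     × Acceptable I x y answer

open DataStructure public using (space)

------------------------------------------------------------------------
-- Set intersection

setIntersection : (c₀ : ℕ) → Problem
setIntersection c₀ = record
  { Instance   = λ N → Fin N → Subset (⌊log₂ N ⌋ ^ c₀)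
  ; Acceptable = λ S i j answer → answer ≡ true ⇔ Nonempty (S i ∩ S j)
  }

SetIntersectionHypothesis : Set
SetIntersectionHypothesis =
  ∃ λ c₀ → (D : DataStructure (setIntersection c₀)) → space D ∈Ω̃ (λ N → N * N)

------------------------------------------------------------------------
-- Graphs

record Graph (n : ℕ) : Set where
  field
    neighbours : Fin n → Subset n
    symmetric  : ∀ {u v} → v ∈ neighbours u → u ∈ neighbours v
    loopless   : ∀ {u} → u ∉ neighbours u

module _ {n : ℕ} (G : Graph n) where
  open Graph G

  degree : Fin n → ℕ
  degree u = ∣ neighbours u ∣

  maxDegree : ℕ
  maxDegree = max 0 (map degree (allFin n))

  data Walk : Fin n → Fin n → ℕ → Set where
    []  : ∀ {u} → Walk u u 0
    _∷_ : ∀ {u v x ℓ} → v ∈ neighbours u → Walk v x ℓ → Walk u x (suc ℓ)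

  -- d(u,v) = m. A shortest walk never repeats a vertex, so that minimising
  -- over walks is the same as minimising over paths.
  Distance : Fin n → Fin n → ℕ → Set
  Distance u v m = Walk u v m × (∀ {ℓ} → Walk u v ℓ → m ≤ ℓ)

  Distance≤ : Fin n → Fin n → ℕ → Set
  Distance≤ u v a = ∃ λ m → Distance u v m × m ≤ a

  -- This includes d(u,v) = ∞, in which case no m is the distance.
  Distance≥ : Fin n → Fin n → ℕ → Set
  Distance≥ u v b = ∀ {m} → Distance u v m → b ≤ m

-- The answer  true  claims d(u,v) ≤ a and  false  claims d(u,v) ≥ b.
-- The thresholds may depend on the number n of vertices.
distinguisher : (family : ∀ n → Graph n → Set) (a b : ℕ → ℕ) → Problem
distinguisher family a b = record
  { Instance   = λ n → Σ (Graph n) (family n)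
  ; Acceptable = λ {n} G u v answer →
        (Distance≤ (proj₁ G) u v (a n) → answer ≡ true)
      × (Distance≥ (proj₁ G) u v (b n) → answer ≡ false)
  }

DistinguisherOracle : (family : ∀ n → Graph n → Set) (a b : ℕ → ℕ) → Set
DistinguisherOracle family a b = DataStructure (distinguisher family a b)

-- n^(1/k) / c₁ ≤ maxDegree G ≤ c₂ · n^(1/k), raised to the k-th power.
MaxDegreeΘRoot : (c₁ c₂ : ℕ) (k : ℕ → ℕ) → ∀ n → Graph n → Set
MaxDegreeΘRoot c₁ c₂ k n G =
  n ≤ (c₁ * maxDegree G) ^ k n × maxDegree G ^ k n ≤ c₂ ^ k n * n

{-# OPTIONS --safe #-}

-- Sets over a polylogarithmic universe are encoded in a butterfly-like graph
-- with layers 0, …, k. A triple (i , x , j) with x in both S i and S j gives a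
-- path from the source i in layer 0 to the target j in layer k, and layer l of
-- that path records a number and a tag: the number i with its low digits
-- replaced by those of j, and the element x modulo a power of some Y. The first
-- layers spell out x while i is still known, the last ones forget x when j is
-- already known, so a path of length k from i to j witnesses one common
-- element. As the graph is layered, any other path from i to j has length at
-- least k + 2. Each step leaves O(n^(1/k)) choices, which bounds the degree; a
-- disjoint star makes the maximum degree large enough.
--
-- A query (i , j) of the set intersection problem becomes the query
-- (2 i , 2 j + 1) of the oracle, which a fixed program prefix computes.
module Submission where

open import Defs
open import Data.Bool.Base using (true; false)
open import Data.Empty using (⊥-elim)
open import Data.Fin.Base using (Fin; zero; suc; toℕ; fromℕ<)
open import Data.Fin.Properties as Fin using (any?; toℕ-injective; toℕ<n; toℕ-fromℕ<)
open import Data.Fin.Subset using (Subset; inside; outside; _∈_; _∩_; _∪_; ⁅_⁆; ∣_∣; Nonempty)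
open import Data.Fin.Subset.Properties
open import Data.List.Base using ([]; _∷_; map; head; drop; allFin)
open import Data.List.Extrema.Nat using (f[argmax]≤v⁺; v≤f[argmax]⁺)
open import Data.List.Membership.Propositional using (lose)
open import Data.List.Membership.Propositional.Properties using (∈-allFin)
import Data.List.Relation.Unary.All as All
import Data.List.Relation.Unary.All.Properties as All
import Data.List.Relation.Unary.Any.Properties as Any
open import Data.Maybe.Base as Maybe using (just; nothing)
open import Data.Nat.Base hiding (∣_-_∣)
open import Data.Nat.Divisibility using (divides-refl; m∣m*n)
open import Data.Nat.DivMod
open import Data.Nat.Logarithm
open import Data.Nat.Properties
open import Data.Nat.Tactic.RingSolver using (solve-∀)
open import Data.Product.Base hiding (swap; map)
open import Data.Sum.Base using (_⊎_; inj₁; inj₂; swap)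
open import Data.Vec.Base using (Vec; []; _∷_; here; there; tabulate)
open import Data.Vec.Properties using (lookup∘tabulate; lookup⇒[]=; []=⇒lookup)
open import Function.Base using (_∘_; id)
open import Function.Bundles using (_⇔_; mk⇔)
open import Relation.Binary.Definitions using (Decidable; DecidableEquality)
open import Relation.Binary.PropositionalEquality hiding ([_])
open import Relation.Nullary
open import Relation.Nullary.Decidable using (dec-true; decidable-stable; _×-dec_; _⊎-dec_; ¬?)
import Relation.Unary as Unary

-- Relocating a query program

relocate : Label → Instruction → Instruction
relocate o (jump l)         = jump (o + l)
relocate o (jumpLess a b l) = jumpLess a b (o + l)
relocate o i                = i

head-drop-map : ∀ {A B : Set} (f : A → B) n xs →
  head (drop n (map f xs)) ≡ Maybe.map f (head (drop n xs))
head-drop-map f zero    []       = refl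
head-drop-map f zero    (x ∷ xs) = refl
head-drop-map f (suc n) []       = refl
head-drop-map f (suc n) (x ∷ xs) = head-drop-map f n xs

update-cong : ∀ {A B : Set} (_≟′_ : DecidableEquality A) {f g : A → B} {a a′ b b′} →
  (∀ x → f x ≡ g x) → a ≡ a′ → b ≡ b′ → ∀ x → update _≟′_ f a b x ≡ update _≟′_ g a′ b′ x
update-cong _≟′_ {a = a} f≗g refl refl x with does (x ≟′ a)
... | true  = refl
... | false = f≗g x

-- The prefix turns the arguments `x` and `y` into `2 x` and `2 y + 1`. Register 2 briefly holds the
-- constant 1 and is cleared again, because `P` expects it to be zero. Jump targets are absolute, so
-- those of `P` move by the 5 added instructions.
oddEven : Program → Program
oddEven P =
  op add 0 0 0 ∷ op add 1 1 1 ∷ const 2 1 ∷ op add 1 1 2 ∷ const 2 0 ∷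
  map (relocate 5) P

module _ (w : ℕ) (P : Program) where

  -- Registers and memory are functions, so without function extensionality
  -- the two runs can only be compared up to pointwise equality.
  run-relocate : ∀ t {pc R R′ M M′} → (∀ r → R r ≡ R′ r) → (∀ a → M a ≡ M′ a) →
    run w (oddEven P) t (state (5 + pc) R M) ≡ run w P t (state pc R′ M′)

  exec-relocate : ∀ t {pc R R′ M M′} i → (∀ r → R r ≡ R′ r) → (∀ a → M a ≡ M′ a) →
    exec w (oddEven P) t (state (5 + pc) R M) (Maybe.map (relocate 5) i) ≡
    exec w P t (state pc R′ M′) i

  run-relocate zero R≗ M≗ = refl
  run-relocate (suc t) {pc} R≗ M≗
    rewrite head-drop-map (relocate 5) pc P = exec-relocate t (head (drop pc P)) R≗ M≗

  exec-relocate t nothing R≗ M≗ = refl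
  exec-relocate t (just (const r m)) R≗ M≗ =
    run-relocate t (update-cong _≟_ R≗ refl refl) M≗
  exec-relocate t (just (op o r a b)) R≗ M≗ =
    run-relocate t (update-cong _≟_ R≗ refl (cong₂ (⟦ o ⟧ w) (R≗ a) (R≗ b))) M≗
  exec-relocate t {M′ = M′} (just (load r a)) R≗ M≗ =
    run-relocate t (update-cong _≟_ R≗ refl (trans (M≗ _) (cong M′ (R≗ a)))) M≗
  exec-relocate t (just (store r a)) R≗ M≗ =
    run-relocate t R≗ (update-cong Fin._≟_ M≗ (R≗ a) (R≗ r))
  exec-relocate t (just (jump l)) R≗ M≗ = run-relocate t R≗ M≗
  exec-relocate t {R′ = R′} (just (jumpLess a b l)) R≗ M≗
    rewrite R≗ a | R≗ b with toℕ (R′ a) <ᵇ toℕ (R′ b)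
  ... | true  = run-relocate t R≗ M≗
  ... | false = run-relocate t R≗ M≗
  exec-relocate t (just (halt r)) R≗ M≗ = cong (λ x → just (isNonzero w x)) (R≗ r)

-- The oracle's arguments are wrapped modulo `2 ^ w` as well, so the prefix may compute modulo
-- `2 ^ w` and no overflow has to be ruled out.
wrap-+ : ∀ w a b → wrap w (toℕ (wrap w a) + toℕ (wrap w b)) ≡ wrap w (a + b)
wrap-+ w a b = toℕ-injective (begin
  toℕ (wrap w (toℕ (wrap w a) + toℕ (wrap w b)))
    ≡⟨ toℕ-fromℕ< _ ⟩
  (toℕ (wrap w a) + toℕ (wrap w b)) % 2 ^ w
    ≡⟨ cong (_% 2 ^ w) (cong₂ _+_ (toℕ-wrap a) (toℕ-wrap b)) ⟩
  (a % 2 ^ w + b % 2 ^ w) % 2 ^ w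
    ≡⟨ %-distribˡ-+ a b (2 ^ w) ⟨
  (a + b) % 2 ^ w
    ≡⟨ toℕ-fromℕ< _ ⟨
  toℕ (wrap w (a + b)) ∎)
  where
  open ≡-Reasoning
  instance
    2^w≢0 : NonZero (2 ^ w)
    2^w≢0 = m^n≢0 2 w
  toℕ-wrap : ∀ m → toℕ (wrap w m) ≡ m % 2 ^ w
  toℕ-wrap m = toℕ-fromℕ< _

run-oddEven : ∀ w P t {s} (v : Vec (Word w) s) x y →
  run w (oddEven P) (5 + t) (initial w v x y) ≡ run w P t (initial w v (x + x) (y + y + 1))
run-oddEven w P t v x y = run-relocate w P t registers≗ (λ _ → refl)
  where
  R : Register → Word w
  R = update _≟_ (update _≟_ (update _≟_ (update _≟_ (update _≟_ (inputs w x y)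
        0 (wrap w (toℕ (wrap w x) + toℕ (wrap w x))))
        1 (wrap w (toℕ (wrap w y) + toℕ (wrap w y))))
        2 (wrap w 1))
        1 (wrap w (toℕ (wrap w (toℕ (wrap w y) + toℕ (wrap w y))) + toℕ (wrap w 1))))
        2 (wrap w 0)
  registers≗ : ∀ r → R r ≡ inputs w (x + x) (y + y + 1) r
  registers≗ 0 = wrap-+ w x x
  registers≗ 1 = trans (cong (λ z → wrap w (toℕ z + toℕ (wrap w 1))) (wrap-+ w y y))
                       (wrap-+ w (y + y) 1)
  registers≗ 2 = refl
  registers≗ (suc (suc (suc r))) = refl

-- Mixed-radix digits

[m+kn]/n≡k : ∀ m k n .{{_ : NonZero n}} → m < n → (m + k * n) / n ≡ k
[m+kn]/n≡k m k n m<n = trans (+-distrib-/-∣ʳ m (divides-refl k))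
  (cong₂ _+_ (m<n⇒m/n≡0 m<n) (m*n/n≡m k n))

m+kn-injective : ∀ {m m′ k k′ n} → m < n → m′ < n → m + k * n ≡ m′ + k′ * n → m ≡ m′ × k ≡ k′
m+kn-injective {m} {m′} {k} {k′} {n@(suc _)} m<n m′<n eq =
  trans (sym (rem m k m<n)) (trans (cong (_% n) eq) (rem m′ k′ m′<n)) ,
  trans (sym ([m+kn]/n≡k m k n m<n)) (trans (cong (_/ n) eq) ([m+kn]/n≡k m′ k′ n m′<n))
  where
  rem : ∀ m k → m < n → (m + k * n) % n ≡ m
  rem m k m<n = trans ([m+kn]%n≡m%n m k n) (m<n⇒m%n≡m m<n)

m+kn<ln : ∀ {m k n l} → m < n → k < l → m + k * n < l * n
m+kn<ln {k = k} {n} m<n k<l = <-≤-trans (+-monoˡ-< (k * n) m<n) (*-monoˡ-≤ n k<l)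

-- mix m i j replaces the part of i below the radix m by that of j.
mix : (m : ℕ) .{{_ : NonZero m}} → ℕ → ℕ → ℕ
mix m i j = j % m + (i / m) * m

module _ (m : ℕ) .{{_ : NonZero m}} where

  mix-% : ∀ i j → mix m i j % m ≡ j % m
  mix-% i j = trans ([m+kn]%n≡m%n (j % m) (i / m) m) (m%n%n≡m%n j m)

  mix-/ : ∀ i j → mix m i j / m ≡ i / m
  mix-/ i j = [m+kn]/n≡k (j % m) (i / m) m (m%n<n j m)

  -- The low part is at most `j` and the high part at most `i`. Their sum can exceed both, hence the
  -- range `N + N` for positions in `code`.
  mix-< : ∀ {i j N} → i < N → j < N → mix m i j < N + N
  mix-< {i} {j} i<N j<N = +-mono-<-≤ (≤-<-trans (m%n≤m j m) j<N) (≤-trans (m/n*n≤m i m) (<⇒≤ i<N))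

  mix-large : ∀ {i j N} → N ≤ m → i < N → j < N → mix m i j ≡ j
  mix-large {i} {j} N≤m i<N j<N = trans
    (cong₂ (λ r q → r + q * m) (m<n⇒m%n≡m (<-≤-trans j<N N≤m)) (m<n⇒m/n≡0 (<-≤-trans i<N N≤m)))
    (+-identityʳ j)

mix-1 : ∀ i j {m} .{{_ : NonZero m}} → m ≡ 1 → mix m i j ≡ i
mix-1 i j refl = trans (cong₂ (λ r q → r + q * 1) (n%1≡0 j) (n/1≡n i)) (*-identityʳ i)

-- For `m′ ≡ m * B` this writes the digit `e` between the two radices and keeps the rest of `p`. The
-- old digit is ignored, so one formula serves for climbing and for descending.
swapDigit : (m m′ : ℕ) .{{_ : NonZero m}} .{{_ : NonZero m′}} → ℕ → ℕ → ℕ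
swapDigit m m′ e p = p % m + e * m + (p / m′) * m′

module _ (m B : ℕ) .{{m≢0 : NonZero m}} .{{B≢0 : NonZero B}} .{{mB≢0 : NonZero (m * B)}} where

  /-digit : ∀ i → (i / m) * m ≡ ((i / m) % B) * m + (i / (m * B)) * (m * B)
  /-digit i = begin
    (i / m) * m
      ≡⟨ cong (_* m) (m≡m%n+[m/n]*n (i / m) B) ⟩
    ((i / m) % B + (i / m / B) * B) * m
      ≡⟨ regroup ((i / m) % B) (i / m / B) B m ⟩
    ((i / m) % B) * m + (i / m / B) * (m * B)
      ≡⟨ cong (λ q → ((i / m) % B) * m + q * (m * B)) (m/n/o≡m/[n*o] i m B) ⟩
    ((i / m) % B) * m + (i / (m * B)) * (m * B) ∎
    where
    open ≡-Reasoning
    regroup : ∀ e q B m → (e + q * B) * m ≡ e * m + q * (m * B)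
    regroup = solve-∀

  %-digit : ∀ j → j % (m * B) ≡ j % m + ((j / m) % B) * m
  %-digit j = +-cancelʳ-≡ ((j / (m * B)) * (m * B)) _ _ (begin
    j % (m * B) + (j / (m * B)) * (m * B)
      ≡⟨ m≡m%n+[m/n]*n j (m * B) ⟨
    j
      ≡⟨ m≡m%n+[m/n]*n j m ⟩
    j % m + (j / m) * m
      ≡⟨ cong (j % m +_) (/-digit j) ⟩
    j % m + (((j / m) % B) * m + (j / (m * B)) * (m * B))
      ≡⟨ +-assoc (j % m) _ _ ⟨
    j % m + ((j / m) % B) * m + (j / (m * B)) * (m * B) ∎)
    where open ≡-Reasoning

module _ (m m′ : ℕ) {B : ℕ} .{{m≢0 : NonZero m}} .{{m′≢0 : NonZero m′}} where

  private
    B≢0 : m′ ≡ m * B → NonZero B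
    B≢0 m′≡mB = m*n≢0⇒n≢0 m {{subst NonZero m′≡mB m′≢0}}

  -- Enlarging the radix exchanges one base-`B` digit of `i` for that of `j`, so the new position is
  -- known up to this digit of `j`. In `mix-down` it is the lost digit of `i` that has to be
  -- supplied.
  mix-up : m′ ≡ m * B → ∀ i j → ∃ λ e → e < B × mix m′ i j ≡ swapDigit m m′ e (mix m i j)
  mix-up refl i j = (j / m) % B , m%n<n (j / m) B , (begin
    j % (m * B) + (i / (m * B)) * (m * B)
      ≡⟨ cong (_+ (i / (m * B)) * (m * B)) (%-digit m B j) ⟩
    j % m + ((j / m) % B) * m + (i / (m * B)) * (m * B)
      ≡⟨ cong₂ (λ r q → r + ((j / m) % B) * m + q * (m * B)) (mix-% m i j) (begin
           p / (m * B)  ≡⟨ m/n/o≡m/[n*o] p m B ⟨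
           p / m / B    ≡⟨ cong (_/ B) (mix-/ m i j) ⟩
           i / m / B    ≡⟨ m/n/o≡m/[n*o] i m B ⟩
           i / (m * B)  ∎) ⟨
    p % m + ((j / m) % B) * m + (p / (m * B)) * (m * B) ∎)
    where
    open ≡-Reasoning
    p = mix m i j
    instance _ = B≢0 refl

  mix-down : m′ ≡ m * B → ∀ i j → ∃ λ e → e < B × mix m i j ≡ swapDigit m m′ e (mix m′ i j)
  mix-down refl i j = (i / m) % B , m%n<n (i / m) B , (begin
    j % m + (i / m) * m
      ≡⟨ cong (j % m +_) (/-digit m B i) ⟩
    j % m + (((i / m) % B) * m + (i / (m * B)) * (m * B))
      ≡⟨ +-assoc (j % m) _ _ ⟨
    j % m + ((i / m) % B) * m + (i / (m * B)) * (m * B)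
      ≡⟨ cong₂ (λ r q → r + ((i / m) % B) * m + q * (m * B)) (begin
           p % m            ≡⟨ m∣n⇒o%n%m≡o%m m (m * B) p (m∣m*n B) ⟨
           p % (m * B) % m  ≡⟨ cong (_% m) (mix-% (m * B) i j) ⟩
           j % (m * B) % m  ≡⟨ m∣n⇒o%n%m≡o%m m (m * B) j (m∣m*n B) ⟩
           j % m            ∎) (mix-/ (m * B) i j) ⟨
    p % m + ((i / m) % B) * m + (p / (m * B)) * (m * B) ∎)
    where
    open ≡-Reasoning
    p = mix (m * B) i j
    instance _ = B≢0 refl

-- Once the residue modulo `a` is known, `F` candidates remain for the residue modulo `a′`. The
-- outer reduction lets one formula cover the gain of a digit, its loss, and a residue that already
-- is the element.
Refines : (X F a a′ : ℕ) .{{_ : NonZero a}} .{{_ : NonZero a′}} → Set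
Refines X F a a′ = ∀ {x} → x < X → ∃ λ f → f < F × x % a′ ≡ (x % a + f * a) % a′

module _ {X : ℕ} (a a′ : ℕ) .{{a≢0 : NonZero a}} .{{a′≢0 : NonZero a′}} where

  Refines-* : ∀ {Y} → a′ ≡ a * Y → Refines X Y a a′
  Refines-* {Y} refl {x} x<X = (x / a) % Y , m%n<n (x / a) Y ,
    trans (sym (m%n%n≡m%n x (a * Y))) (cong (_% (a * Y)) (%-digit a Y x))
    where
    instance
      Y≢0 : NonZero Y
      Y≢0 = m*n≢0⇒n≢0 a

  Refines-coarser : ∀ {Y} → a ≡ a′ * Y → Refines X 1 a a′
  Refines-coarser {Y} refl {x} x<X = 0 , s≤s z≤n ,
    sym (trans (cong (_% a′) (+-identityʳ (x % (a′ * Y)))) (m∣n⇒o%n%m≡o%m a′ (a′ * Y) x (m∣m*n Y)))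

  Refines-large : X ≤ a → Refines X 1 a a′
  Refines-large X≤a {x} x<X = 0 , s≤s z≤n ,
    cong (_% a′) (sym (trans (+-identityʳ (x % a)) (m<n⇒m%n≡m (<-≤-trans x<X X≤a))))

-- Degrees in finite graphs

-- Enumerating numbers instead of elements of `Fin n` allows values of `g` that are no vertices, so
-- formulas for codes can be used without bounds.
Covered : ∀ {n} → ℕ → (Fin n → Set) → Set
Covered D P = ∃ λ (g : ℕ → ℕ) → ∀ {x} → P x → ∃ λ e → e < D × toℕ x ≡ g e

private variable
  n D₁ D₂ D : ℕ
  P Q : Fin n → Set

Covered-⊎ : Covered D₁ P → Covered D₂ Q → Covered (D₁ + D₂) (λ x → P x ⊎ Q x)
Covered-⊎ {D₁ = D₁} {P = P} {D₂ = D₂} {Q = Q} (f , f-covers) (g , g-covers) = h , h-covers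
  where
  h : ℕ → ℕ
  h e with e <? D₁
  ... | yes _ = f e
  ... | no _  = g (e ∸ D₁)
  h-covers : ∀ {x} → P x ⊎ Q x → ∃ λ e → e < D₁ + D₂ × toℕ x ≡ h e
  h-covers (inj₁ p) with f-covers p
  ... | e , e<D₁ , x≡ = e , m≤n⇒m≤n+o D₂ e<D₁ , trans x≡ h≡
    where
    h≡ : f e ≡ h e
    h≡ with e <? D₁
    ... | yes _  = refl
    ... | no e≮D₁ = contradiction e<D₁ e≮D₁
  h-covers (inj₂ q) with g-covers q
  ... | e , e<D₂ , x≡ = D₁ + e , +-monoʳ-< D₁ e<D₂ , trans x≡ h≡
    where
    h≡ : g e ≡ h (D₁ + e)
    h≡ with D₁ + e <? D₁
    ... | yes D₁+e<D₁ = contradiction D₁+e<D₁ (m+n≮m D₁ e)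
    ... | no _      = cong g (sym (m+n∸m≡n D₁ e))

Covered-mono : D₁ ≤ D₂ → Covered D₁ P → Covered D₂ P
Covered-mono D₁≤D₂ (g , covers) = g , λ p →
  let e , e<D₁ , x≡ = covers p in e , <-≤-trans e<D₁ D₁≤D₂ , x≡

Covered-pairs : (g : ℕ → ℕ → ℕ) →
  (∀ {x} → P x → ∃₂ λ e f → e < D₁ × f < D₂ × toℕ x ≡ g e f) → Covered (D₁ * D₂) P
Covered-pairs {D₂ = zero} g covers = (λ _ → 0) , λ p →
  contradiction (proj₁ (proj₂ (proj₂ (proj₂ (covers p))))) n≮0
Covered-pairs {D₁ = D₁} {D₂ = D₂@(suc _)} g covers = (λ r → g (r / D₂) (r % D₂)) , λ p →
  let e , f , e<D₁ , f<D₂ , x≡ = covers p in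
  f + e * D₂ ,
  <-≤-trans (+-monoˡ-< (e * D₂) f<D₂) (*-monoˡ-≤ D₂ e<D₁) ,
  trans x≡ (cong₂ g (sym (quotient e f f<D₂)) (sym (remainder e f f<D₂)))
  where
  remainder : ∀ e f → f < D₂ → (f + e * D₂) % D₂ ≡ f
  remainder e f f<D₂ = trans ([m+kn]%n≡m%n f e D₂) (m<n⇒m%n≡m f<D₂)
  quotient : ∀ e f → f < D₂ → (f + e * D₂) / D₂ ≡ e
  quotient e f = [m+kn]/n≡k f e D₂

-- The enumeration may be built from a witness: the layer, position and tag of a vertex are
-- available only once some rung meets it.
Covered-nonempty : Unary.Decidable P → (∃ P → Covered D₁ P) → Covered D₁ P
Covered-nonempty P? covered with any? P?
... | yes ∃P = covered ∃P
... | no ∄P  = (λ _ → 0) , λ p → contradiction (_ , p) ∄P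

∣p∪q∣≤∣p∣+∣q∣ : (p q : Subset n) → ∣ p ∪ q ∣ ≤ ∣ p ∣ + ∣ q ∣
∣p∪q∣≤∣p∣+∣q∣ [] [] = z≤n
∣p∪q∣≤∣p∣+∣q∣ (outside ∷ p) (outside ∷ q) = ∣p∪q∣≤∣p∣+∣q∣ p q
∣p∪q∣≤∣p∣+∣q∣ (outside ∷ p) (inside ∷ q) =
  ≤-trans (s≤s (∣p∪q∣≤∣p∣+∣q∣ p q)) (≤-reflexive (sym (+-suc ∣ p ∣ ∣ q ∣)))
∣p∪q∣≤∣p∣+∣q∣ (inside ∷ p) (outside ∷ q) = s≤s (∣p∪q∣≤∣p∣+∣q∣ p q)
∣p∪q∣≤∣p∣+∣q∣ (inside ∷ p) (inside ∷ q) =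
  s≤s (≤-trans (∣p∪q∣≤∣p∣+∣q∣ p q) (+-monoʳ-≤ ∣ p ∣ (n≤1+n ∣ q ∣)))

⁅_⁆ᵈ : {P : Fin n → Set} → Unary.Decidable P → Subset n
⁅ P? ⁆ᵈ = tabulate (does ∘ P?)

module _ {P : Fin n → Set} (P? : Unary.Decidable P) where

  ∈⁅⁆ᵈ⁺ : ∀ {x} → P x → x ∈ ⁅ P? ⁆ᵈ
  ∈⁅⁆ᵈ⁺ {x} p = lookup⇒[]= x _ (trans (lookup∘tabulate (does ∘ P?) x) (dec-true (P? x) p))

  ∈⁅⁆ᵈ⁻ : ∀ {x} → x ∈ ⁅ P? ⁆ᵈ → P x
  ∈⁅⁆ᵈ⁻ {x} x∈ with P? x | trans (sym (lookup∘tabulate (does ∘ P?) x)) ([]=⇒lookup x∈)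
  ... | yes p | _ = p

-- Induction on `D`: at most one element of `p` has the last value of `g`, and deleting it leaves a
-- set covered by the earlier values.
Covered⇒∣p∣≤ : (p : Subset n) → Covered D (_∈ p) → ∣ p ∣ ≤ D
Covered⇒∣p∣≤ {n} {zero} p (g , covers) =
  ≤-reflexive (trans (cong ∣_∣ (Empty-unique {p = p} λ (x , x∈p) → n≮0 (proj₁ (proj₂ (covers x∈p)))))
                     (∣⊥∣≡0 n))
Covered⇒∣p∣≤ {n} {suc D} p (g , covers) with any? (λ x → x ∈? p ×-dec toℕ x ≟ g D)
... | no ∄x = m≤n⇒m≤1+n (Covered⇒∣p∣≤ p (g , covers′))
  where
  covers′ : ∀ {x} → x ∈ p → ∃ λ e → e < D × toℕ x ≡ g e
  covers′ x∈p with covers x∈p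
  ... | e , s≤s e≤D , x≡ = e , ≤∧≢⇒< e≤D (λ { refl → ∄x (_ , x∈p , x≡) }) , x≡
... | yes (z , z∈p , z≡) = begin
  ∣ p ∣              ≤⟨ p⊆q⇒∣p∣≤∣q∣ p⊆q∪z ⟩
  ∣ q ∪ ⁅ z ⁆ ∣      ≤⟨ ∣p∪q∣≤∣p∣+∣q∣ q ⁅ z ⁆ ⟩
  ∣ q ∣ + ∣ ⁅ z ⁆ ∣  ≡⟨ cong (∣ q ∣ +_) (∣⁅x⁆∣≡1 z) ⟩
  ∣ q ∣ + 1          ≡⟨ +-comm ∣ q ∣ 1 ⟩
  suc ∣ q ∣          ≤⟨ s≤s (Covered⇒∣p∣≤ q (g , covers′ ∘ ∈⁅⁆ᵈ⁻ Q?)) ⟩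
  suc D              ∎
  where
  open ≤-Reasoning
  Q? : Unary.Decidable (λ x → x ∈ p × toℕ x ≢ g D)
  Q? x = x ∈? p ×-dec ¬? (toℕ x ≟ g D)
  q : Subset n
  q = ⁅ Q? ⁆ᵈ
  p⊆q∪z : ∀ {x} → x ∈ p → x ∈ q ∪ ⁅ z ⁆
  p⊆q∪z {x} x∈p with x Fin.≟ z
  ... | yes refl = x∈p∪q⁺ (inj₂ (x∈⁅x⁆ z))
  ... | no x≢z   = x∈p∪q⁺ (inj₁ (∈⁅⁆ᵈ⁺ Q? (x∈p , λ x≡ → x≢z (toℕ-injective (trans x≡ (sym z≡))))))
  covers′ : ∀ {x} → x ∈ p × toℕ x ≢ g D → ∃ λ e → e < D × toℕ x ≡ g e
  covers′ (x∈p , x≢) with covers x∈p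
  ... | e , s≤s e≤D , x≡ = e , ≤∧≢⇒< e≤D (λ { refl → x≢ x≡ }) , x≡

interval⊆p⇒length≤∣p∣ : ∀ c d (p : Subset n) → c + d ≤ n →
  (∀ x → c ≤ toℕ x → toℕ x < c + d → x ∈ p) → d ≤ ∣ p ∣
interval⊆p⇒length≤∣p∣ c zero p c+d≤n ⊆p = z≤n
interval⊆p⇒length≤∣p∣ zero (suc d) (b ∷ p) (s≤s d≤n) ⊆p with ⊆p zero z≤n (s≤s z≤n)
... | here = s≤s (interval⊆p⇒length≤∣p∣ 0 d p d≤n λ x _ x<d → drop-there (⊆p (suc x) z≤n (s≤s x<d)))
interval⊆p⇒length≤∣p∣ (suc c) d@(suc _) (b ∷ p) (s≤s c+d≤n) ⊆p =
  ≤-trans (interval⊆p⇒length≤∣p∣ c d p c+d≤n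
            λ x c≤x x<c+d → drop-there (⊆p (suc x) (s≤s c≤x) (s≤s x<c+d)))
          (∣p∣≤∣x∷p∣ b p)

module _ {_⇒_ : Fin n → Fin n → Set} (_⇒?_ : Decidable _⇒_) (irreflexive : ∀ {u} → ¬ u ⇒ u) where

  Adjacent : Fin n → Fin n → Set
  Adjacent u v = u ⇒ v ⊎ v ⇒ u

  adjacent? : ∀ u → Unary.Decidable (Adjacent u)
  adjacent? u v = (u ⇒? v) ⊎-dec (v ⇒? u)

  underlying : Graph n
  underlying = record
    { neighbours = λ u → ⁅ adjacent? u ⁆ᵈ
    ; symmetric  = λ {u} {v} v∈ → ∈⁅⁆ᵈ⁺ (adjacent? v) (swap (∈⁅⁆ᵈ⁻ (adjacent? u) v∈))
    ; loopless   = λ {u} u∈ → reduce (∈⁅⁆ᵈ⁻ (adjacent? u) u∈)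
    }
    where
    reduce : ∀ {u} → ¬ Adjacent u u
    reduce (inj₁ u⇒u) = irreflexive u⇒u
    reduce (inj₂ u⇒u) = irreflexive u⇒u

  open Graph underlying

  adjacent⁺ : ∀ {u v} → Adjacent u v → v ∈ neighbours u
  adjacent⁺ {u} = ∈⁅⁆ᵈ⁺ (adjacent? u)

  adjacent⁻ : ∀ {u v} → v ∈ neighbours u → Adjacent u v
  adjacent⁻ {u} = ∈⁅⁆ᵈ⁻ (adjacent? u)

  degree≤ : ∀ {u} → Covered D₁ (u ⇒_) → Covered D₂ (_⇒ u) → degree underlying u ≤ D₁ + D₂
  degree≤ {u = u} out into =
    let g , covers = Covered-⊎ out into in
    Covered⇒∣p∣≤ (neighbours u) (g , covers ∘ adjacent⁻)

module _ (G : Graph n) where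

  maxDegree≤ : (∀ u → degree G u ≤ D) → maxDegree G ≤ D
  maxDegree≤ degree≤D = f[argmax]≤v⁺ {f = id} z≤n (All.map⁺ (All.universal degree≤D (allFin n)))

  degree≤maxDegree : ∀ u → degree G u ≤ maxDegree G
  degree≤maxDegree u = v≤f[argmax]⁺ {f = id} 0 _ (inj₂ (Any.map⁺ (lose (∈-allFin u) ≤-refl)))

-- The layered graph

-- Layer l keeps the digits of i above the radix m l, those of j below it, and
-- the element modulo a l. All of i is present before layer t, all of the element
-- between layers t and r, and all of j after layer r. In a step between adjacent
-- layers, B counts the choices of the digit that changes, and F and G those of
-- the element seen from below and from above.
record Schedule (k N X D : ℕ) : Set where
  field
    m a       : ℕ → ℕ
    m≢0       : ∀ {l} → NonZero (m l)
    a≢0       : ∀ {l} → NonZero (a l)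
    t r       : ℕ
    0<t       : 0 < t
    t≤r       : t ≤ r
    r<k       : r < k
    m-initial : ∀ {l} → l < t → m l ≡ 1
    m-final   : ∀ {l} → r < l → N ≤ m l
    a-first   : a 0 ≡ 1
    a-last    : a k ≡ 1
    a-middle  : ∀ {l} → t ≤ l → l ≤ r → X ≤ a l
  instance
    m-nonZero : ∀ {l} → NonZero (m l)
    m-nonZero = m≢0
    a-nonZero : ∀ {l} → NonZero (a l)
    a-nonZero = a≢0
  field
    step : ∀ {l} → l < k → ∃ λ B → ∃₂ λ F G →
      m (suc l) ≡ m l * B × B * F ≤ D × B * G ≤ D ×
      Refines X F (a l) (a (suc l)) × Refines X G (a (suc l)) (a l)

module Gadget {k N X D : ℕ} .{{_ : NonZero k}} .{{_ : NonZero X}} (σ : Schedule k N X D)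
  {N′ X′ : ℕ} (N′≤N : N′ ≤ N) (X′≤X : X′ ≤ X) (S : Fin N′ → Subset X′)
  (n d : ℕ) (fits : k * X * (N + N) * 2 + suc d ≤ n) where

  open Schedule σ

  -- Layer k carries the odd codes and layer 0 the smallest even ones, so that
  -- the codes of the end points do not involve k, N or X.
  code : (l p y : ℕ) → ℕ
  code l p y = l / k + (p + (y + l % k * X) * (N + N)) * 2

  -- The first number above all codes. The star has its centre here and its `d` leaves right behind;
  -- all later vertices are isolated.
  hub : ℕ
  hub = k * X * (N + N) * 2

  Valid : (l p y : ℕ) → Set
  Valid l p y = l ≤ k × p < N + N × y < X

  l/k<2 : ∀ {l} → l ≤ k → l / k < 2
  l/k<2 {l} l≤k = m<n*o⇒m/o<n
    (≤-<-trans l≤k (m<m+n k (subst (0 <_) (sym (+-identityʳ k)) (>-nonZero⁻¹ k))))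

  code<hub : ∀ {l p y} → Valid l p y → code l p y < hub
  code<hub {l} (l≤k , p< , y<) = m+kn<ln (l/k<2 l≤k) (m+kn<ln p< (m+kn<ln y< (m%n<n l k)))

  code-injective : ∀ {l p y l′ p′ y′} → Valid l p y → Valid l′ p′ y′ →
    code l p y ≡ code l′ p′ y′ → l ≡ l′ × p ≡ p′ × y ≡ y′
  code-injective {l} {l′ = l′} (l≤k , p< , y<) (l′≤k , p′< , y′<) eq =
    let l/k≡ , eq₁ = m+kn-injective (l/k<2 l≤k) (l/k<2 l′≤k) eq
        p≡ , eq₂   = m+kn-injective p< p′< eq₁
        y≡ , l%k≡  = m+kn-injective y< y′< eq₂
    in trans (m≡m%n+[m/n]*n l k)
         (trans (cong₂ (λ r q → r + q * k) l%k≡ l/k≡) (sym (m≡m%n+[m/n]*n l′ k))) ,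
       p≡ , y≡

  Common : Fin N′ → Fin X′ → Fin N′ → Set
  Common i x j = x ∈ S i × x ∈ S j

  position : ℕ → Fin N′ → Fin N′ → ℕ
  position l i j = mix (m l) (toℕ i) (toℕ j)

  tag : ℕ → Fin X′ → ℕ
  tag l x = toℕ x % a l

  toℕ-i<N : (i : Fin N′) → toℕ i < N
  toℕ-i<N i = <-≤-trans (toℕ<n i) N′≤N

  toℕ-x<X : (x : Fin X′) → toℕ x < X
  toℕ-x<X x = <-≤-trans (toℕ<n x) X′≤X

  valid : ∀ {l} → l ≤ k → ∀ i x j → Valid l (position l i j) (tag l x)
  valid {l} l≤k i x j =
    l≤k , mix-< (m l) (toℕ-i<N i) (toℕ-i<N j) , ≤-<-trans (m%n≤m (toℕ x) (a l)) (toℕ-x<X x)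

  point : ℕ → Fin N′ → Fin X′ → Fin N′ → ℕ
  point l i x j = code l (position l i j) (tag l x)

  Rung : Fin n → Fin n → Set
  Rung u v = ∃ λ (l : Fin k) → ∃ λ i → ∃₂ λ x j → Common i x j ×
    toℕ u ≡ point (toℕ l) i x j × toℕ v ≡ point (suc (toℕ l)) i x j

  Spoke : Fin n → Fin n → Set
  Spoke u v = toℕ u ≡ hub × hub < toℕ v × toℕ v < hub + suc d

  _⇒_ : Fin n → Fin n → Set
  u ⇒ v = Rung u v ⊎ Spoke u v

  rung? : Decidable Rung
  rung? u v = any? λ l → any? λ i → any? λ x → any? λ j →
    (x ∈? S i ×-dec x ∈? S j) ×-dec
    toℕ u ≟ point (toℕ l) i x j ×-dec toℕ v ≟ point (suc (toℕ l)) i x j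

  spoke? : Decidable Spoke
  spoke? u v = toℕ u ≟ hub ×-dec hub <? toℕ v ×-dec toℕ v <? hub + suc d

  _⇒?_ : Decidable _⇒_
  u ⇒? v = rung? u v ⊎-dec spoke? u v

  rung-valid : (l : Fin k) → ∀ i x j → Valid (toℕ l) (position (toℕ l) i j) (tag (toℕ l) x)
  rung-valid l = valid (<⇒≤ (toℕ<n l))

  rung-valid′ : (l : Fin k) → ∀ i x j →
    Valid (suc (toℕ l)) (position (suc (toℕ l)) i j) (tag (suc (toℕ l)) x)
  rung-valid′ l = valid (toℕ<n l)

  ⇒-irreflexive : ∀ {u} → ¬ u ⇒ u
  ⇒-irreflexive (inj₁ (l , i , x , j , _ , u≡ , u≡′)) = 1+n≢n (sym (proj₁
    (code-injective (rung-valid l i x j) (rung-valid′ l i x j) (trans (sym u≡) u≡′))))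
  ⇒-irreflexive (inj₂ (u≡hub , hub<u , _)) = <⇒≢ hub<u (sym u≡hub)

  graph : Graph n
  graph = underlying _⇒?_ ⇒-irreflexive

  open Graph graph

  -- The number of `u` reveals layer, position and tag by `code-injective`. The upper end of a rung
  -- is then fixed by the entering digit of `j` and one of `F` values for the tag, at most
  -- `B * F ≤ D` choices. The term `d` counts the spokes at the hub.
  out-covered : ∀ u → Covered (D + d) (u ⇒_)
  out-covered u = Covered-⊎ (Covered-nonempty (rung? u)
      λ (_ , l , i , x , j , _ , u≡ , _) → rungs l (rung-valid l i x j) u≡) spokes
    where
    rungs : ∀ l {p y} → Valid (toℕ l) p y → toℕ u ≡ code (toℕ l) p y → Covered D (Rung u)
    rungs l {p} {y} valid-u u≡ with step (toℕ<n l)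
    ... | B , F , G , m≡ , BF≤D , _ , refines , _ =
      Covered-mono BF≤D (Covered-pairs next covers)
      where
      next : ℕ → ℕ → ℕ
      next e f = code (suc (toℕ l)) (swapDigit (m (toℕ l)) (m (suc (toℕ l))) e p)
                      ((y + f * a (toℕ l)) % a (suc (toℕ l)))
      covers : ∀ {v} → Rung u v → ∃₂ λ e f → e < B × f < F × toℕ v ≡ next e f
      covers (l′ , i , x , j , _ , u≡′ , v≡)
        with code-injective valid-u (rung-valid l′ i x j) (trans (sym u≡) u≡′)
      ... | l≡ , refl , refl with toℕ-injective l≡
      ...   | refl =
        let e , e<B , p′≡ = mix-up (m (toℕ l)) _ m≡ (toℕ i) (toℕ j)
            f , f<F , y′≡ = refines (toℕ-x<X x)
        in e , f , e<B , f<F , trans v≡ (cong₂ (code (suc (toℕ l))) p′≡ y′≡)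
    spokes : Covered d (Spoke u)
    spokes = (λ e → suc hub + e) , λ { {v} (_ , hub<v , v<) →
      toℕ v ∸ suc hub ,
      +-cancelˡ-< (suc hub) _ _ (subst₂ _<_ (sym (m+[n∸m]≡n hub<v)) (+-suc hub d) v<) ,
      sym (m+[n∸m]≡n hub<v) }

  in-covered : ∀ v → Covered (D + 1) (_⇒ v)
  in-covered v = Covered-⊎ (Covered-nonempty (λ u → rung? u v)
      λ (_ , l , i , x , j , _ , _ , v≡) → rungs l (rung-valid′ l i x j) v≡) spokes
    where
    rungs : ∀ l {p y} → Valid (suc (toℕ l)) p y → toℕ v ≡ code (suc (toℕ l)) p y →
      Covered D (λ u → Rung u v)
    rungs l {p} {y} valid-v v≡ with step (toℕ<n l)
    ... | B , F , G , m≡ , _ , BG≤D , _ , refines =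
      Covered-mono BG≤D (Covered-pairs previous covers)
      where
      previous : ℕ → ℕ → ℕ
      previous e f = code (toℕ l) (swapDigit (m (toℕ l)) (m (suc (toℕ l))) e p)
                          ((y + f * a (suc (toℕ l))) % a (toℕ l))
      covers : ∀ {u} → Rung u v → ∃₂ λ e f → e < B × f < G × toℕ u ≡ previous e f
      covers (l′ , i , x , j , _ , u≡ , v≡′)
        with code-injective valid-v (rung-valid′ l′ i x j) (trans (sym v≡) v≡′)
      ... | l≡ , refl , refl with toℕ-injective (suc-injective l≡)
      ...   | refl =
        let e , e<B , p′≡ = mix-down (m (toℕ l)) _ m≡ (toℕ i) (toℕ j)
            f , f<F , y′≡ = refines (toℕ-x<X x)
        in e , f , e<B , f<F , trans u≡ (cong₂ (code (toℕ l)) p′≡ y′≡)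
    spokes : Covered 1 (λ u → Spoke u v)
    spokes = (λ _ → hub) , λ (u≡hub , _) → 0 , s≤s z≤n , u≡hub

  maxDegree-upper : maxDegree graph ≤ D + d + (D + 1)
  maxDegree-upper = maxDegree≤ graph λ u → degree≤ _⇒?_ ⇒-irreflexive (out-covered u) (in-covered u)

  maxDegree-lower : d ≤ maxDegree graph
  maxDegree-lower = ≤-trans
    (interval⊆p⇒length≤∣p∣ (suc hub) d (neighbours centre)
      (subst (_≤ n) (+-suc hub d) fits)
      λ v hub<v v< → adjacent⁺ _⇒?_ ⇒-irreflexive
        (inj₁ (inj₂ (toℕ-fromℕ< _ , hub<v , subst (toℕ v <_) (sym (+-suc hub d)) v<))))
    (degree≤maxDegree graph centre)
    where
    centre : Fin n
    centre = fromℕ< {hub} (<-≤-trans (m<m+n hub (s≤s z≤n)) fits)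

  -- Every rung on an ascending path from layer 0 to layer k may come from a
  -- different triple (i , x , j). The first index cannot change before layer
  -- t, the element cannot change between layers t and r, and the second index
  -- cannot change after layer r.
  record Traced (i : Fin N′) (l p y : ℕ) : Set where
    field
      initially : l < t → p ≡ toℕ i
      inBetween : t ≤ l → l ≤ r → ∃ λ x → x ∈ S i × y ≡ toℕ x
      finally   : r < l → ∃ λ j → Nonempty (S i ∩ S j) × p ≡ toℕ j

  open Traced

  traced-start : ∀ i → Traced i 0 (toℕ i) 0
  traced-start i .initially _ = refl
  traced-start i .inBetween t≤0 _ = ⊥-elim (n≮0 (≤-trans 0<t t≤0))
  traced-start i .finally ()

  position-initial : ∀ {l} → l < t → ∀ i j → position l i j ≡ toℕ i
  position-initial l<t i j = mix-1 (toℕ i) (toℕ j) (m-initial l<t)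

  position-final : ∀ {l} → r < l → ∀ i j → position l i j ≡ toℕ j
  position-final r<l i j = mix-large _ (m-final r<l) (toℕ-i<N i) (toℕ-i<N j)

  tag-middle : ∀ {l} → t ≤ l → l ≤ r → ∀ x → tag l x ≡ toℕ x
  tag-middle t≤l l≤r x = m<n⇒m%n≡m (<-≤-trans (toℕ-x<X x) (a-middle t≤l l≤r))

  -- The triple of the new rung is known only through what the code of its lower end shows. This
  -- suffices at the two handovers: on entering layer `t`, where the lower end still shows all of
  -- `i`, and on leaving layer `r`, where it shows all of `x`.
  traced-step : ∀ {i₀ l i x j} → Common i x j →
    Traced i₀ l (position l i j) (tag l x) → Traced i₀ (suc l) (position (suc l) i j) (tag (suc l) x)
  traced-step {i₀} {l} {i} {x} {j} (x∈Si , x∈Sj) trace = record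
    { initially = λ 1+l<t → trans (position-initial 1+l<t i j) (i≡i₀ (<-trans (n<1+n l) 1+l<t))
    ; inBetween = λ t≤1+l 1+l≤r → x , between t≤1+l (≤-trans (n≤1+n l) 1+l≤r) , tag-middle t≤1+l 1+l≤r x
    ; finally   = λ r<1+l → j , end (≤-pred r<1+l) , position-final r<1+l i j
    }
    where
    i≡i₀ : l < t → toℕ i ≡ toℕ i₀
    i≡i₀ l<t = trans (sym (position-initial l<t i j)) (initially trace l<t)
    x∈Si₀ : t ≤ l → l ≤ r → x ∈ S i₀
    x∈Si₀ t≤l l≤r with inBetween trace t≤l l≤r
    ... | x₀ , x₀∈ , y≡ =
      subst (_∈ S i₀) (toℕ-injective (trans (sym y≡) (tag-middle t≤l l≤r x))) x₀∈
    between : t ≤ suc l → l ≤ r → x ∈ S i₀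
    between t≤1+l l≤r with l <? t
    ... | yes l<t = subst (λ i → x ∈ S i) (toℕ-injective (i≡i₀ l<t)) x∈Si
    ... | no l≮t  = x∈Si₀ (≮⇒≥ l≮t) l≤r
    end : r ≤ l → Nonempty (S i₀ ∩ S j)
    end r≤l with r <? l
    -- Here `l` is `r`, the last layer whose tag is sure to be the whole element: the `x` traced to
    -- `S i₀` is the one that the rung places in `S j`.
    ... | no r≮l  = x , x∈p∩q⁺ (x∈Si₀ (≤-trans t≤r r≤l) (≮⇒≥ r≮l) , x∈Sj)
    ... | yes r<l with finally trace r<l
    ...   | j₀ , nonempty , p≡ =
      subst (λ j → Nonempty (S i₀ ∩ S j))
        (toℕ-injective (trans (sym p≡) (position-final r<l i j))) nonempty

  -- Walks and distances

  At : Fin n → (l p y : ℕ) → Set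
  At u l p y = toℕ u ≡ code l p y × Valid l p y

  -- Codes stay below `hub`, so the star is out of reach and each edge changes the layer by one.
  -- Either every step goes up and carries the trace along, or some step goes down, which makes the
  -- walk at least two longer than its net rise.
  climb : ∀ {u v ℓ l p y} → At u l p y → Walk graph u v ℓ → ∃ λ l′ → ∃₂ λ p′ y′ → At v l′ p′ y′ ×
    (l′ ≡ l + ℓ × (∀ {i} → Traced i l p y → Traced i l′ p′ y′) ⊎ 2 + l′ ≤ l + ℓ)
  climb {l = l} at [] = _ , _ , _ , at , inj₁ (sym (+-identityʳ l) , λ trace → trace)
  climb {ℓ = suc ℓ} {l} (u≡ , valid-u) (w∈ ∷ walk) with adjacent⁻ _⇒?_ ⇒-irreflexive w∈
  ... | inj₁ (inj₂ (u≡hub , _)) = contradiction (trans (sym u≡) u≡hub) (<⇒≢ (code<hub valid-u))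
  ... | inj₂ (inj₂ (_ , hub<u , _)) =
    contradiction (<-trans (subst (hub <_) u≡ hub<u) (code<hub valid-u)) (<-irrefl refl)
  ... | inj₁ (inj₁ (l₁ , i , x , j , common , u≡′ , w≡))
    with code-injective valid-u (rung-valid l₁ i x j) (trans (sym u≡) u≡′)
  ...   | refl , refl , refl with climb (w≡ , rung-valid′ l₁ i x j) walk
  ...     | l′ , p′ , y′ , at , inj₁ (l′≡ , trace) =
    l′ , p′ , y′ , at , inj₁ (trans l′≡ (sym (+-suc (toℕ l₁) ℓ)) , trace ∘ traced-step common)
  ...     | l′ , p′ , y′ , at , inj₂ long =
    l′ , p′ , y′ , at , inj₂ (subst (2 + l′ ≤_) (sym (+-suc (toℕ l₁) ℓ)) long)
  climb {ℓ = suc ℓ} {l} (u≡ , valid-u) (w∈ ∷ walk) | inj₂ (inj₁ (l₁ , i , x , j , common , w≡ , u≡′))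
    with code-injective valid-u (rung-valid′ l₁ i x j) (trans (sym u≡) u≡′)
  ...   | refl , refl , refl with climb (w≡ , rung-valid l₁ i x j) walk
  ...     | l′ , p′ , y′ , at , inj₁ (l′≡ , _) =
    l′ , p′ , y′ , at , inj₂ (≤-reflexive (trans (cong (2 +_) l′≡) (cong suc (sym (+-suc (toℕ l₁) ℓ)))))
  ...     | l′ , p′ , y′ , at , inj₂ long =
    l′ , p′ , y′ , at , inj₂ (≤-trans long (+-mono-≤ (n≤1+n (toℕ l₁)) (n≤1+n ℓ)))

  module _ {i j : Fin N′} {u v : Fin n}
    (u≡ : toℕ u ≡ toℕ i + toℕ i) (v≡ : toℕ v ≡ toℕ j + toℕ j + 1) where

    double : ∀ p r → p + p + r ≡ r + (p + 0) * 2
    double = solve-∀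

    endpoint : ∀ {l} r → l / k ≡ r → l % k ≡ 0 → ∀ p → p + p + r ≡ code l p 0
    endpoint r refl l%k≡0 p rewrite l%k≡0 = double p r

    at-left : At u 0 (toℕ i) 0
    at-left = trans (trans u≡ (sym (+-identityʳ _)))
                (endpoint 0 (0/n≡0 k) (m<n⇒m%n≡m (>-nonZero⁻¹ k)) (toℕ i)) ,
              z≤n , m≤n⇒m≤n+o N (toℕ-i<N i) , >-nonZero⁻¹ X

    at-right : At v k (toℕ j) 0
    at-right = trans v≡ (endpoint 1 (n/n≡1 k) (n%n≡0 k) (toℕ j)) ,
               ≤-refl , m≤n⇒m≤n+o N (toℕ-i<N j) , >-nonZero⁻¹ X

    walk-length : ∀ {ℓ} → Walk graph u v ℓ → (ℓ ≡ k × Nonempty (S i ∩ S j)) ⊎ k + 2 ≤ ℓ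
    walk-length walk with climb at-left walk
    ... | l′ , p′ , y′ , (v≡′ , valid-v) , outcome
      with code-injective valid-v (proj₂ at-right) (trans (sym v≡′) (proj₁ at-right))
    walk-length walk | _ , _ , _ , _ , inj₂ long | refl , refl , refl =
      inj₂ (≤-trans (≤-reflexive (+-comm k 2)) long)
    walk-length walk | _ , _ , _ , _ , inj₁ (k≡ℓ , trace) | refl , refl , refl
      with Traced.finally (trace (traced-start i)) r<k
    ... | j′ , nonempty , j≡ =
      inj₁ (sym k≡ℓ , subst (λ j → Nonempty (S i ∩ S j)) (sym (toℕ-injective j≡)) nonempty)

    disjoint⇒Distance≥ : ¬ Nonempty (S i ∩ S j) → Distance≥ graph u v (k + 2)
    disjoint⇒Distance≥ empty (walk , _) with walk-length walk
    ... | inj₁ (_ , nonempty) = contradiction nonempty empty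
    ... | inj₂ long           = long

    module _ {x : Fin X′} (common : Common i x j) where

      vertex : ∀ l → l ≤ k → Fin n
      vertex l l≤k = fromℕ< {point l i x j}
        (<-≤-trans (code<hub (valid l≤k i x j)) (≤-trans (m≤m+n hub (suc d)) fits))

      toℕ-vertex : ∀ l l≤k → toℕ (vertex l l≤k) ≡ point l i x j
      toℕ-vertex l l≤k = toℕ-fromℕ< _

      ascent : ∀ s l (l≤k : l ≤ k) → s + l ≡ k → Walk graph (vertex l l≤k) (vertex k ≤-refl) s
      ascent zero l l≤k refl = []
      ascent (suc s) l l≤k s+l≡k =
        adjacent⁺ _⇒?_ ⇒-irreflexive {vertex l l≤k} {vertex (suc l) l<k} (inj₁ (inj₁ rung)) ∷
        ascent s (suc l) l<k (trans (+-suc s l) s+l≡k)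
        where
        l<k : l < k
        l<k = subst (l <_) s+l≡k (s≤s (m≤n+m l s))
        rung : Rung (vertex l l≤k) (vertex (suc l) l<k)
        rung = fromℕ< l<k , i , x , j , common ,
          trans (toℕ-vertex l l≤k) (cong (λ l → point l i x j) (sym (toℕ-fromℕ< l<k))) ,
          trans (toℕ-vertex (suc l) l<k) (cong (λ l → point (suc l) i x j) (sym (toℕ-fromℕ< l<k)))

      left-vertex : vertex 0 z≤n ≡ u
      left-vertex = toℕ-injective (trans (toℕ-vertex 0 z≤n)
        (trans (cong₂ (code 0) (position-initial 0<t i j) (trans (%-congʳ a-first) (n%1≡0 (toℕ x))))
               (sym (proj₁ at-left))))

      right-vertex : vertex k ≤-refl ≡ v
      right-vertex = toℕ-injective (trans (toℕ-vertex k ≤-refl)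
        (trans (cong₂ (code k) (position-final r<k i j) (trans (%-congʳ a-last) (n%1≡0 (toℕ x))))
               (sym (proj₁ at-right))))

      ascending-walk : Walk graph u v k
      ascending-walk = subst₂ (λ u v → Walk graph u v k) left-vertex right-vertex
        (ascent k 0 z≤n (+-identityʳ k))

    intersecting⇒Distance≤ : Nonempty (S i ∩ S j) → Distance≤ graph u v k
    intersecting⇒Distance≤ (x , x∈) = k , (ascending-walk (x∈p∩q⁻ (S i) (S j) x∈) , shortest) , ≤-refl
      where
      shortest : ∀ {ℓ} → Walk graph u v ℓ → k ≤ ℓ
      shortest walk with walk-length walk
      ... | inj₁ (ℓ≡k , _) = ≤-reflexive (sym ℓ≡k)
      ... | inj₂ long      = ≤-trans (m≤m+n k 2) long

-- The schedule of radices

-- An element has `suc t′` digits in base `Y`; they appear in the first `suc t′` steps and vanish in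
-- the last `suc t′`. The radix `m` grows by `b` in the step into layer `t`, by `D` in each of the
-- `g` middle steps and by `b` in the step out of layer `r`. The two outer ones share the degree
-- with a tag digit, whence `bY≤D`.
module _ (t′ g N X D Y b : ℕ) .{{D≢0 : NonZero D}} .{{Y≢0 : NonZero Y}} .{{b≢0 : NonZero b}}
  (bY≤D : b * Y ≤ D) (X≤Y^t : X ≤ Y ^ suc t′) (N≤bD^gb : N ≤ b * D ^ g * b) where

  private
    t r k : ℕ
    t = suc t′
    r = t + g
    k = r + t

    t≤r : t ≤ r
    t≤r = m≤m+n t g

    abstract
      m : ℕ → ℕ
      m l with l <? t
      ... | yes _ = 1
      ... | no _ with l ≤? r
      ...   | yes _ = b * D ^ (l ∸ t)
      ...   | no _  = b * D ^ g * b

      -- Between layers `t` and `r` the exponent stays at least `t`. Its further growth is harmless,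
      -- because a modulus of size `X` or more leaves the element as it is.
      a : ℕ → ℕ
      a l = Y ^ (l ⊓ (k ∸ l))

      m≢0 : ∀ {l} → NonZero (m l)
      m≢0 {l} with l <? t
      ... | yes _ = _
      ... | no _ with l ≤? r
      ...   | yes _ = m*n≢0 b (D ^ (l ∸ t)) {{b≢0}} {{m^n≢0 D (l ∸ t)}}
      ...   | no _  = m*n≢0 (b * D ^ g) b {{m*n≢0 b (D ^ g) {{b≢0}} {{m^n≢0 D g}}}} {{b≢0}}

      m-initial : ∀ {l} → l < t → m l ≡ 1
      m-initial {l} l<t with l <? t
      ... | yes _  = refl
      ... | no l≮t = contradiction l<t l≮t

      m-middle : ∀ {l} → t ≤ l → l ≤ r → m l ≡ b * D ^ (l ∸ t)
      m-middle {l} t≤l l≤r with l <? t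
      ... | yes l<t = contradiction t≤l (<⇒≱ l<t)
      ... | no _ with l ≤? r
      ...   | yes _  = refl
      ...   | no l≰r = contradiction l≤r l≰r

      m-final : ∀ {l} → r < l → m l ≡ b * D ^ g * b
      m-final {l} r<l with l <? t
      ... | yes l<t = contradiction (<-trans l<t (≤-<-trans t≤r r<l)) (<-irrefl refl)
      ... | no _ with l ≤? r
      ...   | yes l≤r = contradiction l≤r (<⇒≱ r<l)
      ...   | no _    = refl

      a-rising : ∀ {l} → l ≤ t → a l ≡ Y ^ l
      a-rising {l} l≤t = cong (Y ^_) (m≤n⇒m⊓n≡m (m+n≤o⇒m≤o∸n l (+-mono-≤ (≤-trans l≤t t≤r) l≤t)))

      a-falling : ∀ {l} → r ≤ l → a l ≡ Y ^ (k ∸ l)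
      a-falling {l} r≤l = cong (Y ^_) (m≥n⇒m⊓n≡n (m≤n+o⇒m∸n≤o k l (+-mono-≤ r≤l (≤-trans t≤r r≤l))))

      a-middle : ∀ {l} → t ≤ l → l ≤ r → X ≤ a l
      a-middle {l} t≤l l≤r = ≤-trans X≤Y^t (^-monoʳ-≤ Y (⊓-glb t≤l
        (m+n≤o⇒m≤o∸n t (subst (t + l ≤_) (+-comm t r) (+-monoʳ-≤ t l≤r)))))

      a-first : a 0 ≡ 1
      a-first = refl

      a-last : a k ≡ 1
      a-last = cong (Y ^_) (trans (cong (k ⊓_) (n∸n≡0 k)) (⊓-zeroʳ k))

      a≢0 : ∀ {l} → NonZero (a l)
      a≢0 {l} = m^n≢0 Y (l ⊓ (k ∸ l))

    instance
      a-nonZero : ∀ {l} → NonZero (a l)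
      a-nonZero = a≢0

    a-up : ∀ {l} → l < t → a (suc l) ≡ a l * Y
    a-up {l} l<t = trans (a-rising l<t)
      (trans (*-comm Y (Y ^ l)) (cong (_* Y) (sym (a-rising (<⇒≤ l<t)))))

    a-down : ∀ {l} → r ≤ l → l < k → a l ≡ a (suc l) * Y
    a-down {l} r≤l l<k = trans (a-falling r≤l) (trans (cong (Y ^_) (+-∸-assoc 1 l<k))
      (trans (*-comm Y _) (cong (_* Y) (sym (a-falling (m≤n⇒m≤1+n r≤l))))))

    Y≤D : 1 * Y ≤ D
    Y≤D = ≤-trans (*-monoˡ-≤ Y (>-nonZero⁻¹ b)) bY≤D

    ≤D : ∀ B → B * Y ≤ D → B * 1 ≤ D
    ≤D B = ≤-trans (*-monoʳ-≤ B (>-nonZero⁻¹ Y))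

    Step : ℕ → Set
    Step l = ∃ λ B → ∃₂ λ F G →
      m (suc l) ≡ m l * B × B * F ≤ D × B * G ≤ D ×
      Refines X F (a l) (a (suc l)) × Refines X G (a (suc l)) (a l)

    step-up : ∀ {l} → l < t → Step l
    step-up {l} l<t = let B , m≡ , BY≤D = factor in
      B , Y , 1 , trans m≡ (cong (_* B) (sym (m-initial l<t))) , BY≤D , ≤D B BY≤D ,
      Refines-* (a l) _ (a-up l<t) , Refines-coarser _ (a l) (a-up l<t)
      where
      factor : ∃ λ B → m (suc l) ≡ 1 * B × B * Y ≤ D
      factor with m≤n⇒m<n∨m≡n l<t
      ... | inj₁ 1+l<t = 1 , m-initial 1+l<t , Y≤D
      ... | inj₂ 1+l≡t = b , trans m≡b (sym (*-identityˡ b)) , bY≤D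
        where
        m≡b : m (suc l) ≡ b
        m≡b = trans (cong m 1+l≡t) (trans (m-middle ≤-refl t≤r)
          (trans (cong (λ e → b * D ^ e) (n∸n≡0 t)) (*-identityʳ b)))

    step-across : ∀ {l} → t ≤ l → l < r → Step l
    step-across {l} t≤l l<r = D , 1 , 1 , m≡ , D*1≤D , D*1≤D ,
      Refines-large (a l) (a (suc l)) (a-middle t≤l (<⇒≤ l<r)) ,
      Refines-large (a (suc l)) (a l) (a-middle (m≤n⇒m≤1+n t≤l) l<r)
      where
      D*1≤D : D * 1 ≤ D
      D*1≤D = ≤-reflexive (*-identityʳ D)
      open ≡-Reasoning
      m≡ : m (suc l) ≡ m l * D
      m≡ = begin
        m (suc l)               ≡⟨ m-middle (m≤n⇒m≤1+n t≤l) l<r ⟩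
        b * D ^ (suc l ∸ t)     ≡⟨ cong (λ e → b * D ^ e) (+-∸-assoc 1 t≤l) ⟩
        b * (D * D ^ (l ∸ t))   ≡⟨ cong (b *_) (*-comm D _) ⟩
        b * (D ^ (l ∸ t) * D)   ≡⟨ *-assoc b _ D ⟨
        b * D ^ (l ∸ t) * D     ≡⟨ cong (_* D) (m-middle t≤l (<⇒≤ l<r)) ⟨
        m l * D                 ∎

    step-down : ∀ {l} → r ≤ l → l < k → Step l
    step-down {l} r≤l l<k = let B , m≡ , BY≤D = factor in
      B , 1 , Y , m≡ , ≤D B BY≤D , BY≤D ,
      Refines-coarser (a l) (a (suc l)) (a-down r≤l l<k) , Refines-* _ (a l) (a-down r≤l l<k)
      where
      factor : ∃ λ B → m (suc l) ≡ m l * B × B * Y ≤ D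
      factor with m≤n⇒m<n∨m≡n r≤l
      ... | inj₁ r<l = 1 , trans (m-final (m≤n⇒m≤1+n r<l))
                             (trans (sym (m-final r<l)) (sym (*-identityʳ (m l)))) , Y≤D
      ... | inj₂ r≡l = b , trans (m-final (s≤s r≤l)) (cong (_* b) (sym ml≡)) , bY≤D
        where
        ml≡ : m l ≡ b * D ^ g
        ml≡ = trans (cong m (sym r≡l))
          (trans (m-middle t≤r ≤-refl) (cong (λ e → b * D ^ e) (m+n∸m≡n t g)))

    step : ∀ {l} → l < k → Step l
    step {l} l<k = choose (l <? t) (l <? r)
      where
      choose : Dec (l < t) → Dec (l < r) → Step l
      choose (yes l<t) _         = step-up l<t
      choose (no l≮t)  (yes l<r) = step-across (≮⇒≥ l≮t) l<r
      choose (no _)    (no l≮r)  = step-down (≮⇒≥ l≮r) l<k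

  schedule : Schedule (suc t′ + g + suc t′) N X D
  schedule = record
    { m = m
    ; a = a
    ; m≢0 = m≢0
    ; a≢0 = a≢0
    ; t = t
    ; r = r
    ; 0<t = s≤s z≤n
    ; t≤r = t≤r
    ; r<k = m<m+n r (s≤s z≤n)
    ; m-initial = m-initial
    ; m-final = λ r<l → ≤-trans N≤bD^gb (≤-reflexive (sym (m-final r<l)))
    ; a-first = a-first
    ; a-last = a-last
    ; a-middle = a-middle
    ; step = step
    }

-- Choosing the radices for given n and k

-- A downward search. It yields integer roots, numbers of digits and, for `blowup`, the interval
-- that contains `n`.
crossing : ∀ (F : ℕ → ℕ) {n} m s → F s ≤ n → n < F (m + s) →
  ∃ λ c → s ≤ c × F c ≤ n × n < F (suc c)
crossing F zero s Fs≤n n<Fs = contradiction n<Fs (≤⇒≯ Fs≤n)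
crossing F {n} (suc m) s Fs≤n n<F with F (m + s) ≤? n
... | yes F≤n = m + s , m≤n+m s m , F≤n , n<F
... | no F≰n  = crossing F m s Fs≤n (≰⇒> F≰n)

n<b^n : ∀ {b} → 2 ≤ b → ∀ n → n < b ^ n
n<b^n 2≤b zero = s≤s z≤n
n<b^n {b} 2≤b (suc n) = begin-strict
  suc n          <⟨ +-mono-≤ (>-nonZero⁻¹ _ {{b^n≢0}}) (n<b^n 2≤b n) ⟩
  b ^ n + b ^ n  ≡⟨ cong (b ^ n +_) (+-identityʳ (b ^ n)) ⟨
  2 * b ^ n      ≤⟨ *-monoˡ-≤ (b ^ n) 2≤b ⟩
  b ^ suc n      ∎
  where
  open ≤-Reasoning
  b^n≢0 : NonZero (b ^ n)
  b^n≢0 = m^n≢0 b n {{>-nonZero (<-≤-trans (s≤s z≤n) 2≤b)}}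

^-distribʳ-* : ∀ k m n → (m * n) ^ k ≡ m ^ k * n ^ k
^-distribʳ-* zero    m n = refl
^-distribʳ-* (suc k) m n =
  trans (cong (m * n *_) (^-distribʳ-* k m n)) ([m*n]*[o*p]≡[m*o]*[n*p] m n (m ^ k) (n ^ k))

record Root (n k : ℕ) : Set where
  field
    d     : ℕ
    0<d   : 0 < d
    lower : d ^ k ≤ n
    upper : n < suc d ^ k

root : ∀ {n k} → 0 < n → 0 < k → Root n k
root {n} {k} 0<n 0<k =
  let d , 0<d , lower , upper = crossing (_^ k) n 1
        (subst (_≤ n) (sym (^-zeroˡ k)) 0<n)
        (subst (λ c → n < c ^ k) (+-comm 1 n)
          (≤-trans (≤-reflexive (sym (*-identityʳ (suc n)))) (^-monoʳ-≤ (suc n) 0<k)))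
  in record { d = d ; 0<d = 0<d ; lower = lower ; upper = upper }

record Parameters (N X D k : ℕ) : Set where
  field
    t′ g Y b : ℕ
    Y≢0      : NonZero Y
    b≢0      : NonZero b
    k≡       : k ≡ suc t′ + g + suc t′
    bY≤D     : b * Y ≤ D
    X≤Y^t    : X ≤ Y ^ suc t′
    N≤bD^gb  : N ≤ b * D ^ g * b

-- The factor `4 X^4` is the capacity lost to the tags: the `2 t′` steps that do not widen the radix
-- cost `D^(2 t′) ≤ X^2`, and using `b = D / Y` in place of `D` costs at most a factor `2 X` in each
-- of two steps. So `D^k ≤ 4 X^4 (b D^g b)`, and `N` fits since `4 X^4 N ≤ n < D^k`.
parameters : ∀ {n k N X D} → 2 ≤ k → 1 ≤ N → 2 ≤ X → 2 ≤ D → n < D ^ k →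
  4 * (X * X * X * X) * N ≤ n → Parameters N X D k
parameters {n} {k} {N} {X} {D} 2≤k 1≤N 2≤X 2≤D n<D^k large = record
  { t′ = t′ ; g = g ; Y = Y ; b = b ; Y≢0 = Y≢0 ; b≢0 = b≢0
  ; k≡ = k≡ ; bY≤D = m/n*n≤m D Y ; X≤Y^t = X≤Y^t ; N≤bD^gb = N≤bD^gb }
  where
  Y : ℕ
  Y = X ⊓ D
  2≤Y : 2 ≤ Y
  2≤Y = ⊓-glb 2≤X 2≤D
  instance
    X≢0 : NonZero X
    X≢0 = >-nonZero (<-≤-trans (s≤s z≤n) 2≤X)
    D≢0 : NonZero D
    D≢0 = >-nonZero (<-≤-trans (s≤s z≤n) 2≤D)
    N≢0 : NonZero N
    N≢0 = >-nonZero 1≤N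
    Y≢0 : NonZero Y
    Y≢0 = >-nonZero (<-≤-trans (s≤s z≤n) 2≤Y)
  b : ℕ
  b = D / Y
  b≢0 : NonZero b
  b≢0 = >-nonZero (m≥n⇒m/n>0 (m⊓n≤n X D))

  suc-pred-X : suc (pred X) ≡ X
  suc-pred-X = suc-pred X
  t-crossing : ∃ λ c → 0 ≤ c × Y ^ c ≤ pred X × pred X < Y ^ suc c
  -- Searching with `pred X` makes the bounds read `Y ^ t′ < X ≤ Y ^ suc t′`, so `suc t′` digits are
  -- just enough for an element.
  t-crossing = crossing (Y ^_) (pred X) 0 (≤-pred (subst (2 ≤_) (sym suc-pred-X) 2≤X))
    (subst (λ e → pred X < Y ^ e) (sym (+-identityʳ (pred X))) (n<b^n 2≤Y (pred X)))
  t′ : ℕ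
  t′ = proj₁ t-crossing
  Y^t′<X : Y ^ t′ < X
  Y^t′<X = subst (Y ^ t′ <_) suc-pred-X (s≤s (proj₁ (proj₂ (proj₂ t-crossing))))
  X≤Y^t : X ≤ Y ^ suc t′
  X≤Y^t = subst (_≤ Y ^ suc t′) suc-pred-X (proj₂ (proj₂ (proj₂ t-crossing)))

  -- Either one step is enough to write down an element of X, or every step
  -- but the last uses the full degree D for it.
  waste : D ^ t′ ≤ X × (t′ ≡ 0 ⊎ D ≤ X)
  waste with ≤-total D X
  ... | inj₁ D≤X = <⇒≤ (subst (λ y → y ^ t′ < X) (m≥n⇒m⊓n≡n D≤X) Y^t′<X) , inj₂ D≤X
  ... | inj₂ X≤D = one-step t′ (subst (λ y → y ^ t′ < X) (m≤n⇒m⊓n≡m X≤D) Y^t′<X)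
    where
    one-step : ∀ t′ → X ^ t′ < X → D ^ t′ ≤ X × (t′ ≡ 0 ⊎ D ≤ X)
    one-step zero    1<X = <⇒≤ 1<X , inj₁ refl
    one-step (suc t) X^t<X = contradiction (m≤m*n X (X ^ t) {{m^n≢0 X t}}) (<⇒≱ X^t<X)

  open ≤-Reasoning

  X³≤n : X * X * X ≤ n
  X³≤n = begin
    X * X * X                ≤⟨ m≤m*n (X * X * X) X ⟩
    X * X * X * X            ≤⟨ m≤n*m (X * X * X * X) 4 ⟩
    4 * (X * X * X * X)      ≤⟨ m≤m*n _ N ⟩
    4 * (X * X * X * X) * N  ≤⟨ large ⟩
    n                        ∎

  -- Otherwise `k ≤ 2 t′ + 1`. For `t′ = 0` this contradicts `2 ≤ k`; else `D ≤ X` and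
  -- `n < D^k ≤ D^t′ D^t′ D ≤ X^3 ≤ n`.
  2t≤k : suc t′ + suc t′ ≤ k
  2t≤k with suc t′ + suc t′ ≤? k
  ... | yes 2t≤k = 2t≤k
  ... | no 2t≰k with proj₂ waste
  ...   | inj₁ t′≡0 = contradiction (subst (λ t → suc t + suc t ≤ k) (sym t′≡0) 2≤k) 2t≰k
  ...   | inj₂ D≤X  = contradiction X³≤n (<⇒≱ (begin-strict
    n                     <⟨ n<D^k ⟩
    D ^ k                 ≤⟨ ^-monoʳ-≤ D (≤-pred (≤-trans (≰⇒> 2t≰k) (≤-reflexive (double+2 t′)))) ⟩
    D ^ (t′ + t′ + 1)     ≡⟨ ^-distribˡ-+-* D (t′ + t′) 1 ⟩
    D ^ (t′ + t′) * D ^ 1 ≡⟨ cong₂ _*_ (^-distribˡ-+-* D t′ t′) (*-identityʳ D) ⟩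
    D ^ t′ * D ^ t′ * D   ≤⟨ *-mono-≤ (*-mono-≤ (proj₁ waste) (proj₁ waste)) D≤X ⟩
    X * X * X             ∎))
    where
    double+2 : ∀ t → suc t + suc t ≡ suc (t + t + 1)
    double+2 = solve-∀

  g : ℕ
  g = k ∸ (suc t′ + suc t′)

  k≡ : k ≡ suc t′ + g + suc t′
  k≡ = trans (sym (m+[n∸m]≡n 2t≤k)) (rearrange (suc t′) g)
    where
    rearrange : ∀ t g → t + t + g ≡ t + g + t
    rearrange = solve-∀

  D≤2bX : D ≤ b * X + b * X
  D≤2bX = begin
    D              ≡⟨ m≡m%n+[m/n]*n D Y ⟩
    D % Y + b * Y  ≤⟨ +-monoˡ-≤ (b * Y) (≤-trans (<⇒≤ (m%n<n D Y)) (m≤n*m Y b {{b≢0}})) ⟩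
    b * Y + b * Y  ≤⟨ +-mono-≤ (*-monoʳ-≤ b (m⊓n≤m X D)) (*-monoʳ-≤ b (m⊓n≤m X D)) ⟩
    b * X + b * X  ∎

  D^k≤ : D ^ k ≤ 4 * (X * X * X * X) * (b * D ^ g * b)
  D^k≤ = begin
    D ^ k
      ≡⟨ cong (D ^_) (trans k≡ (split t′ g)) ⟩
    D ^ (t′ + t′ + (2 + g))
      ≡⟨ ^-distribˡ-+-* D (t′ + t′) (2 + g) ⟩
    D ^ (t′ + t′) * (D * (D * D ^ g))
      ≡⟨ cong₂ _*_ (^-distribˡ-+-* D t′ t′) (sym (*-assoc D D (D ^ g))) ⟩
    D ^ t′ * D ^ t′ * (D * D * D ^ g)
      ≤⟨ *-mono-≤ (*-mono-≤ (proj₁ waste) (proj₁ waste))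
           (*-monoˡ-≤ (D ^ g) (*-mono-≤ D≤2bX D≤2bX)) ⟩
    X * X * ((b * X + b * X) * (b * X + b * X) * D ^ g)
      ≡⟨ collect X b (D ^ g) ⟩
    4 * (X * X * X * X) * (b * D ^ g * b) ∎
    where
    split : ∀ t g → suc t + g + suc t ≡ t + t + (2 + g)
    split = solve-∀
    collect : ∀ X b G →
      X * X * ((b * X + b * X) * (b * X + b * X) * G) ≡ 4 * (X * X * X * X) * (b * G * b)
    collect = solve-∀

  N≤bD^gb : N ≤ b * D ^ g * b
  N≤bD^gb = <⇒≤ (*-cancelˡ-< (4 * (X * X * X * X)) _ _ (≤-<-trans large (<-≤-trans n<D^k D^k≤)))

record IntersectionGraph (n k : ℕ) {N X : ℕ} (S : Fin N → Subset X) : Set where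
  field
    graph        : Graph n
    degree-lower : n ≤ (2 * maxDegree graph) ^ k
    degree-upper : maxDegree graph ^ k ≤ 6 ^ k * n
    intersecting : ∀ {i j u v} → toℕ u ≡ toℕ i + toℕ i → toℕ v ≡ toℕ j + toℕ j + 1 →
                   Nonempty (S i ∩ S j) → Distance≤ graph u v k
    disjoint     : ∀ {i j u v} → toℕ u ≡ toℕ i + toℕ i → toℕ v ≡ toℕ j + toℕ j + 1 →
                   ¬ Nonempty (S i ∩ S j) → Distance≥ graph u v (k + 2)

-- Let `d` be the integer part of the `k`-th root of `n`, and `D = d + 1`. The star forces maximum
-- degree at least `d ≥ (d + 1) / 2`, and no degree exceeds `D + d + (D + 1) = 3 d + 3 ≤ 6 d`: hence
-- the constants 2 and 6. The codes take at most half of the vertices, which leaves room for the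
-- star.
intersectionGraph : ∀ {n k N X N′ X′} → 2 ≤ k → 1 ≤ N → 2 ≤ X → 8 ≤ n →
  4 * (X * X * X * X) * N ≤ n → k * X * (N + N) * 2 * 2 ≤ n →
  N′ ≤ N → X′ ≤ X → (S : Fin N′ → Subset X′) → IntersectionGraph n k S
intersectionGraph {n} {k} {N} {X} 2≤k 1≤N 2≤X 8≤n large hub≤n N′≤N X′≤X S = record
  { graph        = graph
  ; degree-lower = begin
      n                          ≤⟨ <⇒≤ upper ⟩
      suc d ^ k                  ≤⟨ ^-monoˡ-≤ k 1+d≤2d ⟩
      (2 * d) ^ k                ≤⟨ ^-monoˡ-≤ k (*-monoʳ-≤ 2 maxDegree-lower) ⟩
      (2 * maxDegree graph) ^ k  ∎
  ; degree-upper = begin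
      maxDegree graph ^ k        ≤⟨ ^-monoˡ-≤ k (≤-trans maxDegree-upper 3d+3≤6d) ⟩
      (6 * d) ^ k                ≡⟨ ^-distribʳ-* k 6 d ⟩
      6 ^ k * d ^ k              ≤⟨ *-monoʳ-≤ (6 ^ k) lower ⟩
      6 ^ k * n                  ∎
  ; intersecting = intersecting⇒Distance≤
  ; disjoint     = disjoint⇒Distance≥
  }
  where
  open ≤-Reasoning
  open Root (root {n} {k} (<-≤-trans (s≤s z≤n) 8≤n) (<-≤-trans (s≤s z≤n) 2≤k))
  open Parameters (parameters {D = suc d} 2≤k 1≤N 2≤X (s≤s 0<d) upper large)
  instance
    k≢0 : NonZero k
    k≢0 = >-nonZero (<-≤-trans (s≤s z≤n) 2≤k)
    X≢0 : NonZero X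
    X≢0 = >-nonZero (<-≤-trans (s≤s z≤n) 2≤X)
    d≢0 : NonZero d
    d≢0 = >-nonZero 0<d
  σ : Schedule k N X (suc d)
  σ = subst (λ k → Schedule k N X (suc d)) (sym k≡)
    (schedule t′ g N X (suc d) Y b {{_}} {{Y≢0}} {{b≢0}} bY≤D X≤Y^t N≤bD^gb)

  1+d≤2d : suc d ≤ 2 * d
  1+d≤2d = ≤-trans (+-monoˡ-≤ d 0<d) (≤-reflexive (cong (d +_) (sym (+-identityʳ d))))

  3d+3≤6d : suc d + d + (suc d + 1) ≤ 6 * d
  3d+3≤6d = begin
    suc d + d + (suc d + 1)  ≡⟨ expand d ⟩
    3 * d + 3 * 1            ≤⟨ +-monoʳ-≤ (3 * d) (*-monoʳ-≤ 3 0<d) ⟩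
    3 * d + 3 * d            ≡⟨ *-distribʳ-+ d 3 3 ⟨
    6 * d                    ∎
    where
    expand : ∀ d → suc d + d + (suc d + 1) ≡ 3 * d + 3 * 1
    expand = solve-∀

  2[1+d]≤n : suc d * 2 ≤ n
  2[1+d]≤n with 4 ≤? d
  -- For `d ≤ 3` the star has at most 4 vertices; `8 ≤ n` serves this case.
  ... | no 4≰d  = ≤-trans (*-monoˡ-≤ 2 (≰⇒> 4≰d)) 8≤n
  ... | yes 4≤d = begin
    suc d * 2      ≤⟨ *-monoˡ-≤ 2 (+-monoˡ-≤ d 0<d) ⟩
    (d + d) * 2    ≡⟨ quadruple d ⟩
    4 * d          ≤⟨ *-monoˡ-≤ d 4≤d ⟩
    d * d          ≡⟨ cong (d *_) (*-identityʳ d) ⟨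
    d ^ 2          ≤⟨ ^-monoʳ-≤ d 2≤k ⟩
    d ^ k          ≤⟨ lower ⟩
    n              ∎
    where
    quadruple : ∀ d → (d + d) * 2 ≡ 4 * d
    quadruple = solve-∀

  fits : k * X * (N + N) * 2 + suc d ≤ n
  fits = *-cancelʳ-≤ _ n 2 (begin
    (k * X * (N + N) * 2 + suc d) * 2      ≡⟨ *-distribʳ-+ 2 (k * X * (N + N) * 2) (suc d) ⟩
    k * X * (N + N) * 2 * 2 + suc d * 2    ≤⟨ +-mono-≤ hub≤n 2[1+d]≤n ⟩
    n + n                                  ≡⟨ cong (n +_) (+-identityʳ n) ⟨
    2 * n                                  ≡⟨ *-comm 2 n ⟩
    n * 2                                  ∎)

  open Gadget σ N′≤N X′≤X S n d fits

-- The reduction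

minimiser : ∀ (f : ℕ → ℕ) {lo hi} → lo < hi →
  ∃ λ n → lo ≤ n × n < hi × (∀ {n′} → lo ≤ n′ → n′ < hi → f n ≤ f n′)
minimiser f {lo} {suc hi} (s≤s lo≤hi) with m≤n⇒m<n∨m≡n lo≤hi
... | inj₂ refl = lo , ≤-refl , ≤-refl , λ lo≤n′ n′≤lo →
  ≤-reflexive (cong f (≤-antisym lo≤n′ (≤-pred n′≤lo)))
... | inj₁ lo<hi with minimiser f lo<hi
...   | n , lo≤n , n<hi , minimal with ≤-total (f n) (f hi)
...     | inj₁ fn≤fhi = n , lo≤n , m≤n⇒m≤1+n n<hi , minimal′
  where
  minimal′ : ∀ {n′} → lo ≤ n′ → n′ < suc hi → f n ≤ f n′
  minimal′ lo≤n′ n′≤hi with m≤n⇒m<n∨m≡n (≤-pred n′≤hi)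
  ... | inj₁ n′<hi = minimal lo≤n′ n′<hi
  ... | inj₂ refl  = fn≤fhi
...     | inj₂ fhi≤fn = hi , lo≤hi , ≤-refl , minimal′
  where
  minimal′ : ∀ {n′} → lo ≤ n′ → n′ < suc hi → f hi ≤ f n′
  minimal′ lo≤n′ n′≤hi with m≤n⇒m<n∨m≡n (≤-pred n′≤hi)
  ... | inj₁ n′<hi = ≤-trans fhi≤fn (minimal lo≤n′ n′<hi)
  ... | inj₂ refl  = ≤-refl

n<2^[1+⌊log₂n⌋] : ∀ n → n < 2 ^ suc ⌊log₂ n ⌋
n<2^[1+⌊log₂n⌋] n = ≰⇒> λ 2^≤n → 1+n≰n
  (subst (_≤ ⌊log₂ n ⌋) (⌊log₂[2^n]⌋≡n (suc ⌊log₂ n ⌋)) (⌊log₂⌋-mono-≤ 2^≤n))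

n≤2^m⇒⌊log₂n⌋≤m : ∀ {n m} → n ≤ 2 ^ m → ⌊log₂ n ⌋ ≤ m
n≤2^m⇒⌊log₂n⌋≤m {m = m} n≤2^m = subst (_ ≤_) (⌊log₂[2^n]⌋≡n m) (⌊log₂⌋-mono-≤ n≤2^m)

module Reduction (c₀ : ℕ) (k : ℕ → ℕ) (n₀ : ℕ)
  (k-range : ∀ n → n₀ ≤ n → 2 ≤ k n × k n ≤ ⌊log₂ n ⌋)
  (O : DistinguisherOracle (MaxDegreeΘRoot 2 6 k) k (λ n → k n + 2)) where

  private module O = DataStructure O

  L : ℕ → ℕ
  L N = suc ⌊log₂ N ⌋

  c : ℕ
  c = suc c₀

  abstract
    -- The part `4 * c` pays for `X^4`, and the 2 for a factor `L N ^ 2` that absorbs the constant 4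
    -- in `large` and `8 * κ` in `hub-fits`.
    e : ℕ
    e = 4 * c + 2

    e≡4c+2 : e ≡ 4 * c + 2
    e≡4c+2 = refl

  A : ℕ
  A = suc e

  abstract
    -- The first term gives `8 * A ≤ L N` from `N₀` on; the second puts all sizes used into the
    -- range where `k` is constrained.
    N₀ : ℕ
    N₀ = 2 ^ (8 * A) + n₀

    2^8A≤N₀ : 2 ^ (8 * A) ≤ N₀
    2^8A≤N₀ = m≤m+n (2 ^ (8 * A)) n₀

    n₀≤N₀ : n₀ ≤ N₀
    n₀≤N₀ = m≤n+m n₀ (2 ^ (8 * A))

  -- An instance with N sets is turned into a graph whose number of vertices
  -- lies in [blowup N, blowup (1 + N)).
  blowup : ℕ → ℕ
  blowup N = N * L N ^ e

  L-mono-≤ : ∀ {M N} → M ≤ N → L M ≤ L N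
  L-mono-≤ M≤N = s≤s (⌊log₂⌋-mono-≤ M≤N)

  N≤blowup : ∀ N → N ≤ blowup N
  N≤blowup N = m≤m*n N (L N ^ e) {{m^n≢0 (L N) e}}

  blowup-< : ∀ N → blowup N < blowup (suc N)
  blowup-< N = <-≤-trans (*-monoˡ-< (L N ^ e) {{m^n≢0 (L N) e}} (n<1+n N))
    (*-monoʳ-≤ (suc N) (^-monoˡ-≤ e (L-mono-≤ (n≤1+n N))))

  log-blowup : ∀ {n N} → n < blowup (suc N) → ⌊log₂ n ⌋ ≤ L N * A
  log-blowup {n} {N} n< = n≤2^m⇒⌊log₂n⌋≤m (begin
    n                        ≤⟨ <⇒≤ n< ⟩
    suc N * L (suc N) ^ e    ≤⟨ *-mono-≤ 1+N≤ (^-monoˡ-≤ e L≤) ⟩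
    2 ^ L N * (2 ^ L N) ^ e  ≡⟨ ^-*-assoc 2 (L N) (suc e) ⟩
    2 ^ (L N * A)            ∎)
    where
    open ≤-Reasoning
    1+N≤ : suc N ≤ 2 ^ L N
    1+N≤ = n<2^[1+⌊log₂n⌋] N
    L≤ : L (suc N) ≤ 2 ^ L N
    L≤ = <-≤-trans (s≤s (n≤2^m⇒⌊log₂n⌋≤m 1+N≤)) (n<b^n {2} ≤-refl (L N))

  module _ {N : ℕ} (N₀≤N : N₀ ≤ N) where

    open ≤-Reasoning

    8A≤L : 8 * A ≤ L N
    8A≤L = m≤n⇒m≤1+n (subst (_≤ ⌊log₂ N ⌋) (⌊log₂[2^n]⌋≡n (8 * A))
      (⌊log₂⌋-mono-≤ (≤-trans 2^8A≤N₀ N₀≤N)))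

    2≤L : 2 ≤ L N
    2≤L = ≤-trans (≤-trans (s≤s (s≤s z≤n)) (m≤m*n 8 A)) 8A≤L

    8≤N : 8 ≤ N
    8≤N = ≤-trans (≤-trans (m≤m*n 8 A) (<⇒≤ (n<b^n {2} ≤-refl (8 * A))))
            (≤-trans 2^8A≤N₀ N₀≤N)

    2≤L^e : 2 ≤ L N ^ e
    2≤L^e = ≤-trans 2≤L (≤-trans (≤-reflexive (sym (^-identityʳ (L N))))
      (^-monoʳ-≤ (L N) (subst (1 ≤_) (sym e≡4c+2) (≤-trans (s≤s z≤n) (m≤n+m 2 (4 * c))))))

    N+N≤blowup : N + N ≤ blowup N
    N+N≤blowup = begin
      N + N        ≡⟨ double N ⟩
      N * 2        ≤⟨ *-monoʳ-≤ N 2≤L^e ⟩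
      N * L N ^ e  ∎
      where
      double : ∀ N → N + N ≡ N * 2
      double = solve-∀

    X : ℕ
    X = L N ^ c

    2≤X : 2 ≤ X
    2≤X = ≤-trans 2≤L (m≤m*n (L N) (L N ^ c₀) {{m^n≢0 (L N) c₀}})

    X^4≡ : X * X * X * X ≡ L N ^ (4 * c)
    X^4≡ = trans (regroup X) (trans (^-*-assoc (L N) c 4) (cong (L N ^_) (*-comm c 4)))
      where
      regroup : ∀ X → X * X * X * X ≡ X * (X * (X * (X * 1)))
      regroup = solve-∀

    L^e≡ : L N ^ e ≡ L N ^ (4 * c) * L N ^ 2
    L^e≡ = trans (cong (L N ^_) e≡4c+2) (^-distribˡ-+-* (L N) (4 * c) 2)

    c+2≤e : c + 2 ≤ e
    c+2≤e = subst (c + 2 ≤_) (sym e≡4c+2) (+-monoˡ-≤ 2 (m≤n*m c 4))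

    large : 4 * (X * X * X * X) * N ≤ blowup N
    large = begin
      4 * (X * X * X * X) * N        ≡⟨ cong (λ x → 4 * x * N) X^4≡ ⟩
      4 * L N ^ (4 * c) * N          ≤⟨ *-monoˡ-≤ N (*-monoˡ-≤ (L N ^ (4 * c)) (*-mono-≤ 2≤L 2≤L)) ⟩
      L N * L N * L N ^ (4 * c) * N  ≡⟨ regroup (L N) (L N ^ (4 * c)) N ⟩
      N * (L N ^ (4 * c) * L N ^ 2)  ≡⟨ cong (N *_) L^e≡ ⟨
      N * L N ^ e                    ∎
      where
      regroup : ∀ l x N → l * l * x * N ≡ N * (x * (l * (l * 1)))
      regroup = solve-∀

    hub-fits : ∀ {κ} → κ ≤ L N * A → κ * X * (N + N) * 2 * 2 ≤ blowup N
    hub-fits {κ} κ≤ = begin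
      κ * X * (N + N) * 2 * 2          ≡⟨ regroup κ X N ⟩
      N * (X * (8 * κ))                ≤⟨ *-monoʳ-≤ N (*-monoʳ-≤ X (*-monoʳ-≤ 8 κ≤)) ⟩
      N * (X * (8 * (L N * A)))        ≡⟨ cong (λ x → N * (X * x)) (regroup′ (L N) A) ⟩
      N * (X * (8 * A * L N))          ≤⟨ *-monoʳ-≤ N (*-monoʳ-≤ X (*-monoˡ-≤ (L N) 8A≤L)) ⟩
      N * (X * (L N * L N))            ≡⟨ cong (λ x → N * (X * (L N * x))) (*-identityʳ (L N)) ⟨
      N * (L N ^ c * L N ^ 2)          ≡⟨ cong (N *_) (^-distribˡ-+-* (L N) c 2) ⟨
      N * L N ^ (c + 2)                ≤⟨ *-monoʳ-≤ N (^-monoʳ-≤ (L N) c+2≤e) ⟩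
      N * L N ^ e                      ∎
      where
      regroup : ∀ κ X N → κ * X * (N + N) * 2 * 2 ≡ N * (X * (8 * κ))
      regroup = solve-∀
      regroup′ : ∀ l A → 8 * (l * A) ≡ 8 * A * l
      regroup′ = solve-∀

  instanceGraph : ∀ {n N N′} → N₀ ≤ N → blowup N ≤ n → n < blowup (suc N) → N′ ≤ N →
    (S : Fin N′ → Subset (⌊log₂ N′ ⌋ ^ c₀)) → IntersectionGraph n (k n) S
  instanceGraph {n} {N} {N′} N₀≤N blowup≤n n< N′≤N = intersectionGraph
    (proj₁ range) (≤-trans (s≤s z≤n) (8≤N N₀≤N)) (2≤X N₀≤N)
    (≤-trans (8≤N N₀≤N) N≤n) (≤-trans (large N₀≤N) blowup≤n)
    (≤-trans (hub-fits N₀≤N (≤-trans (proj₂ range) (log-blowup {n} {N} n<))) blowup≤n)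
    N′≤N
    (≤-trans (^-monoˡ-≤ c₀ (≤-trans (⌊log₂⌋-mono-≤ N′≤N) (n≤1+n _))) (m≤n*m (L N ^ c₀) (L N)))
    where
    N≤n : N ≤ n
    N≤n = ≤-trans (N≤blowup N) blowup≤n
    range : 2 ≤ k n × k n ≤ ⌊log₂ n ⌋
    range = k-range n (≤-trans n₀≤N₀ (≤-trans N₀≤N N≤n))

  -- The hypothesis bounds the space only at the sizes that the reduction
  -- uses, so in each interval the cheapest number of vertices is chosen.
  vertices : ∀ N → ∃ λ n → blowup N ≤ n × n < blowup (suc N) ×
    (∀ {n′} → blowup N ≤ n′ → n′ < blowup (suc N) → space O n ≤ space O n′)
  vertices N = minimiser (space O) (blowup-< N)

  -- A data structure has to serve every `N`; below `N₀` it uses a graph built for `N₀` sets.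
  N₁ size : ℕ → ℕ
  N₁ N   = N ⊔ N₀
  size N = proj₁ (vertices (N₁ N))

  blowup≤size : ∀ N → blowup (N₁ N) ≤ size N
  blowup≤size N = proj₁ (proj₂ (vertices (N₁ N)))

  size<blowup : ∀ N → size N < blowup (suc (N₁ N))
  size<blowup N = proj₁ (proj₂ (proj₂ (vertices (N₁ N))))

  -- Needed for the word size. A maximum of positive numbers is at most their product, so one
  -- constant factor also covers `N` below `N₀`.
  L-size : ∀ N → L (size N) ≤ suc (L N₀ * A) * L N
  L-size N = begin
    L (size N)                ≤⟨ s≤s (log-blowup {size N} {N₁ N} (size<blowup N)) ⟩
    suc (L (N₁ N) * A)        ≤⟨ s≤s (*-monoˡ-≤ A (L-N₁)) ⟩
    suc (L N * L N₀ * A)      ≤⟨ +-monoˡ-≤ _ (s≤s z≤n) ⟩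
    L N + L N * L N₀ * A      ≡⟨ regroup (L N) (L N₀) A ⟩
    suc (L N₀ * A) * L N      ∎
    where
    open ≤-Reasoning
    regroup : ∀ l l₀ A → l + l * l₀ * A ≡ suc (l₀ * A) * l
    regroup = solve-∀
    L-N₁ : L (N₁ N) ≤ L N * L N₀
    L-N₁ with ⊔-sel N N₀
    ... | inj₁ N₁≡N  = subst (λ M → L M ≤ L N * L N₀) (sym N₁≡N) (m≤m*n (L N) (L N₀))
    ... | inj₂ N₁≡N₀ = subst (λ M → L M ≤ L N * L N₀) (sym N₁≡N₀) (m≤n*m (L N₀) (L N))

  N≤N₁ : ∀ N → N ≤ N₁ N
  N≤N₁ N = m≤m⊔n N N₀

  N≤size : ∀ N → N ≤ size N
  N≤size N = ≤-trans (N≤N₁ N) (≤-trans (N≤blowup (N₁ N)) (blowup≤size N))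

  N+N≤size : ∀ N → N + N ≤ size N
  N+N≤size N = ≤-trans (+-mono-≤ (N≤N₁ N) (N≤N₁ N))
    (≤-trans (N+N≤blowup (m≤n⊔m N N₀)) (blowup≤size N))

  intersectionGraphOf : ∀ {N} (S : Fin N → Subset (⌊log₂ N ⌋ ^ c₀)) →
    IntersectionGraph (size N) (k (size N)) S
  intersectionGraphOf {N} = instanceGraph (m≤n⊔m N N₀) (blowup≤size N) (size<blowup N) (N≤N₁ N)

  oracleInstance : ∀ {N} → (Fin N → Subset (⌊log₂ N ⌋ ^ c₀)) →
    Σ (Graph (size N)) (MaxDegreeΘRoot 2 6 k (size N))
  oracleInstance S = graph , degree-lower , degree-upper
    where open IntersectionGraph (intersectionGraphOf S)

  correct : ∀ {N} (S : Fin N → Subset (⌊log₂ N ⌋ ^ c₀)) (i j : Fin N) → ∃ λ answer →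
    run (O.wordSize (size N)) (oddEven O.program) (5 + O.time)
      (initial (O.wordSize (size N)) (O.preprocess (oracleInstance S)) (toℕ i) (toℕ j)) ≡ just answer
    × (answer ≡ true ⇔ Nonempty (S i ∩ S j))
  correct {N} S i j = answer ,
    trans (run-oddEven w O.program O.time image₀ (toℕ i) (toℕ j))
      (trans (sym (cong₂ (λ x y → run w O.program O.time (initial w image₀ x y)) u≡ v≡))
             (proj₁ (proj₂ query))) ,
    mk⇔ sound complete
    where
    open IntersectionGraph (intersectionGraphOf S)
    w      = O.wordSize (size N)
    image₀ = O.preprocess (oracleInstance S)
    j+j+1<N+N : toℕ j + toℕ j + 1 < N + N
    j+j+1<N+N = subst (_≤ N + N) (shift (toℕ j)) (+-mono-≤ (toℕ<n j) (toℕ<n j))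
      where
      shift : ∀ j → suc j + suc j ≡ suc (j + j + 1)
      shift = solve-∀
    u v : Fin (size N)
    u = fromℕ< {toℕ i + toℕ i} (<-≤-trans (+-mono-< (toℕ<n i) (toℕ<n i)) (N+N≤size N))
    v = fromℕ< {toℕ j + toℕ j + 1} (<-≤-trans j+j+1<N+N (N+N≤size N))
    u≡ : toℕ u ≡ toℕ i + toℕ i
    u≡ = toℕ-fromℕ< _
    v≡ : toℕ v ≡ toℕ j + toℕ j + 1
    v≡ = toℕ-fromℕ< _
    query  = O.correct (oracleInstance S) u v
    answer = proj₁ query
    complete : Nonempty (S i ∩ S j) → answer ≡ true
    complete nonempty = proj₁ (proj₂ (proj₂ query)) (intersecting {i} {j} {u} {v} u≡ v≡ nonempty)
    sound : answer ≡ true → Nonempty (S i ∩ S j)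
    -- The answer true excludes a distance of at least `k + 2`, hence disjointness; as nonemptiness
    -- is decidable, the sets intersect.
    sound answer≡true = decidable-stable (nonempty? (S i ∩ S j)) λ empty →
      contradiction
        (trans (sym answer≡true) (proj₂ (proj₂ (proj₂ query)) (disjoint {i} {j} {u} {v} u≡ v≡ empty)))
        λ ()

  setIntersectionStructure : DataStructure (setIntersection c₀)
  setIntersectionStructure = record
    { wordSize       = λ N → O.wordSize (size N)
    ; wordSizeFactor = O.wordSizeFactor * suc (L N₀ * A)
    ; wordSize-lower = λ N → ≤-trans (N≤size N) (O.wordSize-lower (size N))
    ; wordSize-upper = λ N → ≤-trans (O.wordSize-upper (size N))
        (≤-trans (*-monoʳ-≤ O.wordSizeFactor (L-size N))
          (≤-reflexive (sym (*-assoc O.wordSizeFactor (suc (L N₀ * A)) (L N)))))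
    ; space          = λ N → space O (size N)
    ; preprocess     = λ S → O.preprocess (oracleInstance S)
    ; program        = oddEven O.program
    ; time           = 5 + O.time
    ; correct        = correct
    }

  -- Each large `n` lies in an interval from `blowup N` to `blowup (suc N)`, where the size chosen
  -- for `N` is cheapest, so `space O n` is at least the space that the hypothesis bounds. Moreover
  -- `n ≤ 2 N (2 log n)^e`; squaring this costs the constant `4 * (2 ^ e * 2 ^ e)` and `e + e`
  -- logarithms.
  lowerBound : space setIntersectionStructure ∈Ω̃ (λ N → N * N) → space O ∈Ω̃ (λ n → n * n)
  lowerBound (C , f , M , bound) =
    C * (4 * (2 ^ e * 2 ^ e)) , f + (e + e) , blowup s , main
    where
    s : ℕ
    s = M ⊔ N₀
    main : ∀ n → blowup s ≤ n →
      n * n ≤ C * (4 * (2 ^ e * 2 ^ e)) * ⌊log₂ n ⌋ ^ (f + (e + e)) * space O n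
    main n blowup≤n
      with crossing blowup (suc n) s blowup≤n (≤-trans (m≤m+n (suc n) s) (N≤blowup (suc n + s)))
    ... | N , s≤N , N≤n , n<N⁺ = begin
      n * n
        ≤⟨ *-mono-≤ n≤ n≤ ⟩
      (N + N) * (2 ^ e * l ^ e) * ((N + N) * (2 ^ e * l ^ e))
        ≡⟨ regroup N (2 ^ e) (l ^ e) ⟩
      4 * (2 ^ e * 2 ^ e) * (l ^ e * l ^ e) * (N * N)
        ≤⟨ *-monoʳ-≤ (4 * (2 ^ e * 2 ^ e) * (l ^ e * l ^ e)) N*N≤ ⟩
      4 * (2 ^ e * 2 ^ e) * (l ^ e * l ^ e) * (C * l ^ f * space O n)
        ≡⟨ regroup′ (4 * (2 ^ e * 2 ^ e)) (l ^ e * l ^ e) C (l ^ f) (space O n) ⟩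
      C * (4 * (2 ^ e * 2 ^ e)) * (l ^ f * (l ^ e * l ^ e)) * space O n
        ≡⟨ cong (λ x → C * (4 * (2 ^ e * 2 ^ e)) * x * space O n)
             (trans (^-distribˡ-+-* l f (e + e)) (cong (l ^ f *_) (^-distribˡ-+-* l e e))) ⟨
      C * (4 * (2 ^ e * 2 ^ e)) * l ^ (f + (e + e)) * space O n ∎
      where
      open ≤-Reasoning
      l : ℕ
      l = ⌊log₂ n ⌋
      regroup : ∀ N t p → (N + N) * (t * p) * ((N + N) * (t * p)) ≡ 4 * (t * t) * (p * p) * (N * N)
      regroup = solve-∀
      regroup′ : ∀ t p C q s → t * p * (C * q * s) ≡ C * t * (q * p) * s
      regroup′ = solve-∀
      N₀≤N : N₀ ≤ N
      N₀≤N = ≤-trans (m≤n⊔m M N₀) s≤N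
      1+N≤N+N : suc N ≤ N + N
      1+N≤N+N = +-monoˡ-≤ N (≤-trans (s≤s z≤n) (8≤N N₀≤N))
      1+N≤n : suc N ≤ n
      1+N≤n = ≤-trans 1+N≤N+N (≤-trans (N+N≤blowup N₀≤N) N≤n)
      1≤l : 1 ≤ l
      1≤l = ⌊log₂⌋-mono-≤ {2} (≤-trans (s≤s (≤-trans (s≤s z≤n) (8≤N N₀≤N))) 1+N≤n)
      L≤2l : L (suc N) ≤ 2 * l
      L≤2l = +-mono-≤ 1≤l (≤-trans (⌊log₂⌋-mono-≤ 1+N≤n) (≤-reflexive (sym (+-identityʳ l))))
      n≤ : n ≤ (N + N) * (2 ^ e * l ^ e)
      n≤ = begin
        n                        ≤⟨ <⇒≤ n<N⁺ ⟩
        suc N * L (suc N) ^ e    ≤⟨ *-mono-≤ 1+N≤N+N (^-monoˡ-≤ e L≤2l) ⟩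
        (N + N) * (2 * l) ^ e    ≡⟨ cong ((N + N) *_) (^-distribʳ-* e 2 l) ⟩
        (N + N) * (2 ^ e * l ^ e) ∎
      N₁≡N : N₁ N ≡ N
      N₁≡N = m≥n⇒m⊔n≡m N₀≤N
      space≤ : space O (size N) ≤ space O n
      space≤ = proj₂ (proj₂ (proj₂ (vertices (N₁ N))))
        (subst (λ N → blowup N ≤ n) (sym N₁≡N) N≤n)
        (subst (λ N → n < blowup (suc N)) (sym N₁≡N) n<N⁺)
      N*N≤ : N * N ≤ C * l ^ f * space O n
      N*N≤ = ≤-trans (bound N (≤-trans (m≤m⊔n M N₀) s≤N))
        (*-mono-≤ (*-monoʳ-≤ C (^-monoˡ-≤ f (⌊log₂⌋-mono-≤ (≤-trans (n≤1+n N) 1+N≤n)))) space≤)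

lemma1p7 : SetIntersectionHypothesis →
    ∃ λ c₁ → ∃ λ c₂ → NonZero c₁ × NonZero c₂ ×
    ((k : ℕ → ℕ) →
    Eventually (λ n → 2 ≤ k n × k n ≤ ⌊log₂ n ⌋) →
    (D : DistinguisherOracle (MaxDegreeΘRoot c₁ c₂ k) k (λ n → k n + 2)) →
    space D ∈Ω̃ (λ n → n * n))
lemma1p7 (c₀ , hypothesis) = 2 , 6 , _ , _ , λ k (n₀ , k-range) O →
  let open Reduction c₀ k n₀ k-range O in lowerBound (hypothesis setIntersectionStructure)
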